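{- Let $a$ be a rational number with $a\in\mathbb{Z}_p^{\times}$ for every prime $p\in\{2,3,5,\dots\}$, and let $b=c$ be a rational number that is not zero or a negative integer. Let $$F(a,b;c;x)=\sum_{n=0}^{\infty}\frac{(a)_n(b)_n}{(c)_n\,n!}x^n$$ be the hypergeometric series. If $x=(x_\infty,x_2,\dots,x_p,\dots)$ is an adele with $|x_v|_v<1$ for all $v\in\{\infty,2,3,\dots,p,\dots\}$, then the sequence $$\mathcal{G}(x)=\big(F(a,b;c;x_\infty),F(a,b;c;x_2),\dots,F(a,b;c;x_p),\dots\big)$$ is an idele, and hence an adele.
   Context: $(a)_n=a(a+1)\cdots(a+n-1)$ is the Pochhammer symbol, with $(a)_0=1$. $|\cdot|_\infty$ is the usual absolute value on $\mathbb{R}$; for a prime $p$, $|\cdot|_p$ is the $p$-adic absolute value on $\mathbb{Q}_p$, $\mathbb{Z}_p$ is the ring of $p$-adic integers and $\mathbb{Z}_p^\times$ its group of units. An adele is an infinite sequence $(a_\infty,a_2,\dots,a_p,\dots)$, indexed by $\infty$ and the primes, with $a_\infty\in\mathbb{R}$, $a_p\in\mathbb{Q}_p$, and $a_p\in\mathbb{Z}_p$ for all but finitely many $p$; adeles form a ring under componentwise operations. An idele is an invertible element of this ring, i.e. a sequence $(\lambda_\infty,\lambda_2,\dots,\lambda_p,\dots)$ with $\lambda_\infty\in\mathbb{R}\setminus\{0\}$, $\lambda_p\in\mathbb{Q}_p\setminus\{0\}$ for all $p$, and $|\lambda_p|_p=1$ for all but finitely many $p$. The component at $v$ of $\mathcal{G}(x)$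 is the sum of the series in $\mathbb{R}$ for $v=\infty$ and in $\mathbb{Q}_p$ for $v=p$. -}

module Defs where

open import Algebra.Bundles using (CommutativeRing)
open import Algebra.Definitions using (Invertible)
import Algebra.Properties.Semiring.Exp as Exp
open import Data.Empty using (⊥-elim)
open import Data.Integer as ℤ using (ℤ; +_)
import Data.Integer.Divisibility.Signed as ℤ∣
import Data.Integer.Properties as ℤₚ
open import Data.List using (List; []; _++_)
open import Data.List.Membership.Propositional using (_∉_)
open import Data.List.Membership.Propositional.Properties using (∈-++⁺ˡ; ∈-++⁺ʳ)
open import Data.Nat as ℕ using (ℕ; zero; suc; _!)
open import Data.Nat.Divisibility as ℕ∣ using (_∣_; _∤_; _∣?_; divides; quotient)
open import Data.Nat.Primality using (Prime; prime?; prime⇒nonZero; prime⇒nonTrivial; euclidsLemma)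
import Data.Nat.Properties as ℕₚ
open import Data.Product using (Σ; Σ-syntax; ∃; ∃-syntax; _×_; _,_; proj₁; proj₂)
open import Data.Rational as ℚ using (ℚ; 0ℚ; 1ℚ; ½; _+_; _*_; _-_; -_; _<_; _≤_; _/_; _÷_; ↥_; ↧_; ↧ₙ_; 1/_)
import Data.Rational.Properties as ℚₚ
open import Data.Rational.Solver using (module +-*-Solver)
import Data.Rational.Unnormalised as ℚᵘ
import Data.Rational.Unnormalised.Properties as ℚᵘₚ
open import Data.Sum using (_⊎_; inj₁; inj₂; [_,_]′)
open import Function using (_∘_)
open import Level using (0ℓ)
open import Relation.Binary.PropositionalEquality
  using (_≡_; _≢_; refl; sym; trans; cong; cong₂; subst; module ≡-Reasoning)
open import Relation.Nullary using (yes; no; contradiction)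
open import Relation.Nullary.Decidable using (recompute)

record AbsoluteValue : Set where
  field
    abs          : ℚ → ℚ
    abs-nonNeg   : ∀ x → 0ℚ ≤ abs x
    abs-0        : abs 0ℚ ≡ 0ℚ
    abs-definite : ∀ x → abs x ≡ 0ℚ → x ≡ 0ℚ
    abs-neg      : ∀ x → abs (- x) ≡ abs x
    abs-*        : ∀ x y → abs (x * y) ≡ abs x * abs y
    abs-+        : ∀ x y → abs (x + y) ≤ abs x + abs y

archimedean : AbsoluteValue
archimedean = record
  { abs          = ℚ.∣_∣
  ; abs-nonNeg   = λ x → ℚₚ.nonNegative⁻¹ ℚ.∣ x ∣ {{ℚₚ.∣-∣-nonNeg x}}
  ; abs-0        = refl
  ; abs-definite = ℚₚ.∣p∣≡0⇒p≡0
  ; abs-neg      = ℚₚ.∣-p∣≡∣p∣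
  ; abs-*        = ℚₚ.∣p*q∣≡∣p∣*∣q∣
  ; abs-+        = ℚₚ.∣p+q∣≤∣p∣+∣q∣
  }

-- The first argument bounds the number of divisions by p; since p ≥ 2 and
-- n ≠ 0 in all uses, the bound n in valuation is never reached.
valuationWithin : ℕ → ℕ → ℕ → ℕ
valuationWithin zero    p n = 0
valuationWithin (suc k) p n with p ∣? n
... | no  _   = 0
... | yes p∣n = suc (valuationWithin k p (quotient p∣n))

valuation : ℕ → ℕ → ℕ
valuation p n = valuationWithin n p n

module _ (p : ℕ) .{{_ : ℕ.NonZero p}} where

  natAbs : ℕ → ℚ
  natAbs zero        = 0ℚ
  natAbs n@(suc _) = (+ 1 / (p ℕ.^ valuation p n)) {{ℕₚ.m^n≢0 p (valuation p n)}}

  -- The denominator of q is nonzero, so p ^ valuation p (↧ₙ q) is 1 / ∣ ↧ₙ q ∣ₚ.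
  padicAbs : ℚ → ℚ
  padicAbs q = natAbs ℤ.∣ ↥ q ∣ * (+ (p ℕ.^ valuation p (↧ₙ q)) / 1)

module ValuationProperties (p : ℕ) (pr : Prime p) where

  instance
    p≢0 : ℕ.NonZero p
    p≢0 = prime⇒nonZero pr

  1<p : 1 ℕ.< p
  1<p = ℕ.nonTrivial⇒n>1 p {{prime⇒nonTrivial pr}}

  valuationWithin-spec : ∀ k n → n ≢ 0 → n ℕ.≤ k →
    ∃[ m ] n ≡ p ℕ.^ valuationWithin k p n ℕ.* m × p ∤ m
  valuationWithin-spec zero    n n≢0 n≤0 = contradiction (ℕₚ.n≤0⇒n≡0 n≤0) n≢0
  valuationWithin-spec (suc k) n n≢0 n≤k with p ∣? n
  ... | no  p∤n            = n , sym (ℕₚ.+-identityʳ n) , p∤n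
  ... | yes (divides q eq) with valuationWithin-spec k q q≢0 q≤k
    where
    q≢0 : q ≢ 0
    q≢0 q≡0 = n≢0 (trans eq (cong (ℕ._* p) q≡0))
    q≤k : q ℕ.≤ k
    q≤k = ℕ.s≤s⁻¹ (ℕₚ.≤-trans
      (ℕₚ.≤-trans (ℕₚ.m<m*n q p {{ℕ.≢-nonZero q≢0}} 1<p) (ℕₚ.≤-reflexive (sym eq))) n≤k)
  ... | m , q≡ , p∤m = m , n≡ , p∤m
    where
    open ≡-Reasoning
    n≡ : n ≡ p ℕ.* p ℕ.^ valuationWithin k p q ℕ.* m
    n≡ = begin
      n                                            ≡⟨ eq ⟩
      q ℕ.* p                                      ≡⟨ ℕₚ.*-comm q p ⟩
      p ℕ.* q                                      ≡⟨ cong (p ℕ.*_) q≡ ⟩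
      p ℕ.* (p ℕ.^ valuationWithin k p q ℕ.* m)    ≡⟨ ℕₚ.*-assoc p _ m ⟨
      p ℕ.* p ℕ.^ valuationWithin k p q ℕ.* m      ∎

  valuation-spec : ∀ n → n ≢ 0 → ∃[ m ] n ≡ p ℕ.^ valuation p n ℕ.* m × p ∤ m
  valuation-spec n n≢0 = valuationWithin-spec n n n≢0 ℕₚ.≤-refl

  ^∣⇒≤ : ∀ j k m → p ∤ m → p ℕ.^ j ∣ p ℕ.^ k ℕ.* m → j ℕ.≤ k
  ^∣⇒≤ zero    k       m p∤m d = ℕ.z≤n
  ^∣⇒≤ (suc j) zero    m p∤m d = contradiction
    (ℕ∣.∣-trans (ℕ∣.m∣m*n (p ℕ.^ j)) (subst (p ℕ.^ suc j ∣_) (ℕₚ.+-identityʳ m) d)) p∤m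
  ^∣⇒≤ (suc j) (suc k) m p∤m d = ℕ.s≤s (^∣⇒≤ j k m p∤m
    (ℕ∣.*-cancelˡ-∣ p (subst (p ℕ.* p ℕ.^ j ∣_) (ℕₚ.*-assoc p (p ℕ.^ k) m) d)))

  ^∣⇒≤valuation : ∀ j n → n ≢ 0 → p ℕ.^ j ∣ n → j ℕ.≤ valuation p n
  ^∣⇒≤valuation j n n≢0 d with valuation-spec n n≢0
  ... | m , eq , p∤m = ^∣⇒≤ j _ m p∤m (subst (p ℕ.^ j ∣_) eq d)

  ^valuation∣ : ∀ n → n ≢ 0 → p ℕ.^ valuation p n ∣ n
  ^valuation∣ n n≢0 with valuation-spec n n≢0
  ... | m , eq , _ = divides m (trans eq (ℕₚ.*-comm _ m))

  ^-mono-∣ : ∀ {j k} → j ℕ.≤ k → p ℕ.^ j ∣ p ℕ.^ k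
  ^-mono-∣ {j} {k} j≤k = divides (p ℕ.^ (k ℕ.∸ j)) (trans (cong (p ℕ.^_) (sym (ℕₚ.m∸n+n≡m j≤k)))
    (ℕₚ.^-distribˡ-+-* p (k ℕ.∸ j) j))

  valuation-unique : ∀ k n m → n ≢ 0 → n ≡ p ℕ.^ k ℕ.* m → p ∤ m → valuation p n ≡ k
  valuation-unique k n m n≢0 eq p∤m = ℕₚ.≤-antisym
    (^∣⇒≤ _ k m p∤m (subst (p ℕ.^ valuation p n ∣_) eq (^valuation∣ n n≢0)))
    (^∣⇒≤valuation k n n≢0 (divides m (trans eq (ℕₚ.*-comm _ m))))

  valuation-* : ∀ m n → m ≢ 0 → n ≢ 0 →
    valuation p (m ℕ.* n) ≡ valuation p m ℕ.+ valuation p n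
  valuation-* m n m≢0 n≢0 with valuation-spec m m≢0 | valuation-spec n n≢0
  ... | m′ , m≡ , p∤m′ | n′ , n≡ , p∤n′ =
    valuation-unique (a ℕ.+ b) (m ℕ.* n) (m′ ℕ.* n′) mn≢0 eq
      (λ d → [ p∤m′ , p∤n′ ]′ (euclidsLemma m′ n′ pr d))
    where
    a = valuation p m
    b = valuation p n
    mn≢0 : m ℕ.* n ≢ 0
    mn≢0 e = [ m≢0 , n≢0 ]′ (ℕₚ.m*n≡0⇒m≡0∨n≡0 m e)
    open ≡-Reasoning
    eq : m ℕ.* n ≡ p ℕ.^ (a ℕ.+ b) ℕ.* (m′ ℕ.* n′)
    eq = begin
      m ℕ.* n                                    ≡⟨ cong₂ ℕ._*_ m≡ n≡ ⟩
      (p ℕ.^ a ℕ.* m′) ℕ.* (p ℕ.^ b ℕ.* n′)      ≡⟨ ℕₚ.[m*n]*[o*p]≡[m*o]*[n*p] (p ℕ.^ a) m′ (p ℕ.^ b) n′ ⟩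
      (p ℕ.^ a ℕ.* p ℕ.^ b) ℕ.* (m′ ℕ.* n′)      ≡⟨ cong (ℕ._* (m′ ℕ.* n′)) (ℕₚ.^-distribˡ-+-* p a b) ⟨
      p ℕ.^ (a ℕ.+ b) ℕ.* (m′ ℕ.* n′)            ∎

module PadicAbs (p : ℕ) (pr : Prime p) where

  open ValuationProperties p pr

  N : ℕ → ℚ
  N = natAbs p

  P : ℕ → ℚ
  P k = + (p ℕ.^ k) / 1

  R : ℕ → ℚ
  R k = (+ 1 / (p ℕ.^ k)) {{ℕₚ.m^n≢0 p k}}

  *-/1 : ∀ m n → (+ (m ℕ.* n) / 1) ≡ (+ m / 1) * (+ n / 1)
  *-/1 m n = ℚₚ.toℚᵘ-injective (begin
    ℚ.toℚᵘ (+ (m ℕ.* n) / 1)                        ≈⟨ ℚₚ.toℚᵘ-fromℚᵘ (ℚᵘ.mkℚᵘ (+ (m ℕ.* n)) 0) ⟩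
    ℚᵘ.mkℚᵘ (+ (m ℕ.* n)) 0                         ≈⟨ ℚᵘ.*≡* (cong (ℤ._* + 1) (ℤₚ.pos-* m n)) ⟩
    ℚᵘ.mkℚᵘ (+ m) 0 ℚᵘ.* ℚᵘ.mkℚᵘ (+ n) 0            ≈⟨ ℚᵘₚ.*-cong (ℚₚ.toℚᵘ-fromℚᵘ (ℚᵘ.mkℚᵘ (+ m) 0)) (ℚₚ.toℚᵘ-fromℚᵘ (ℚᵘ.mkℚᵘ (+ n) 0)) ⟨
    ℚ.toℚᵘ (+ m / 1) ℚᵘ.* ℚ.toℚᵘ (+ n / 1)          ≈⟨ ℚₚ.toℚᵘ-homo-* (+ m / 1) (+ n / 1) ⟨
    ℚ.toℚᵘ ((+ m / 1) * (+ n / 1))                  ∎)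
    where open ℚᵘₚ.≃-Reasoning

  1/*/1 : ∀ n .{{_ : ℕ.NonZero n}} → (+ 1 / n) * (+ n / 1) ≡ 1ℚ
  1/*/1 n@(suc k) = ℚₚ.toℚᵘ-injective (begin
    ℚ.toℚᵘ ((+ 1 / n) * (+ n / 1))          ≈⟨ ℚₚ.toℚᵘ-homo-* (+ 1 / n) (+ n / 1) ⟩
    ℚ.toℚᵘ (+ 1 / n) ℚᵘ.* ℚ.toℚᵘ (+ n / 1)  ≈⟨ ℚᵘₚ.*-cong (ℚₚ.toℚᵘ-fromℚᵘ (ℚᵘ.mkℚᵘ (+ 1) k)) (ℚₚ.toℚᵘ-fromℚᵘ (ℚᵘ.mkℚᵘ (+ n) 0)) ⟩
    ℚᵘ.mkℚᵘ (+ 1) k ℚᵘ.* ℚᵘ.mkℚᵘ (+ n) 0    ≈⟨ ℚᵘ.*≡* (ℤₚ.*-assoc (+ 1) (+ n) (+ 1)) ⟩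
    ℚ.toℚᵘ 1ℚ                               ∎)
    where open ℚᵘₚ.≃-Reasoning

  P-pos : ∀ k → ℚ.Positive (P k)
  P-pos k = ℚₚ.normalize-pos (p ℕ.^ k) 1 {{_}} {{ℕₚ.m^n≢0 p k}}

  R-pos : ∀ k → ℚ.Positive (R k)
  R-pos k = ℚₚ.normalize-pos 1 (p ℕ.^ k) {{ℕₚ.m^n≢0 p k}}

  R*P : ∀ k → R k * P k ≡ 1ℚ
  R*P k = 1/*/1 (p ℕ.^ k) {{ℕₚ.m^n≢0 p k}}

  P-+ : ∀ j k → P (j ℕ.+ k) ≡ P j * P k
  P-+ j k = trans (cong (λ n → + n / 1) (ℕₚ.^-distribˡ-+-* p j k)) (*-/1 (p ℕ.^ j) (p ℕ.^ k))

  R-+ : ∀ j k → R (j ℕ.+ k) ≡ R j * R k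
  R-+ j k = begin
    R (j ℕ.+ k)                              ≡⟨ ℚₚ.*-identityʳ _ ⟨
    R (j ℕ.+ k) * 1ℚ                         ≡⟨ cong (R (j ℕ.+ k) *_) (cong₂ _*_ (R*P j) (R*P k)) ⟨
    R (j ℕ.+ k) * (R j * P j * (R k * P k))  ≡⟨ solve 5 (λ r a b c d → r :* (a :* b :* (c :* d)) := a :* c :* (r :* (b :* d))) refl (R (j ℕ.+ k)) (R j) (P j) (R k) (P k) ⟩
    R j * R k * (R (j ℕ.+ k) * (P j * P k))  ≡⟨ cong (λ t → R j * R k * (R (j ℕ.+ k) * t)) (P-+ j k) ⟨
    R j * R k * (R (j ℕ.+ k) * P (j ℕ.+ k))  ≡⟨ cong (R j * R k *_) (R*P (j ℕ.+ k)) ⟩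
    R j * R k * 1ℚ                           ≡⟨ ℚₚ.*-identityʳ _ ⟩
    R j * R k                                ∎
    where
    open ≡-Reasoning
    open +-*-Solver

  R≤1 : ∀ k → R k ≤ 1ℚ
  R≤1 k = ℚₚ.toℚᵘ-cancel-≤ (ℚᵘₚ.≤-respˡ-≃ (ℚᵘₚ.≃-sym (go (p ℕ.^ k) {{ℕₚ.m^n≢0 p k}})) (le (p ℕ.^ k) {{ℕₚ.m^n≢0 p k}}))
    where
    go : ∀ n .{{_ : ℕ.NonZero n}} → ℚ.toℚᵘ (+ 1 / n) ℚᵘ.≃ (+ 1 ℚᵘ./ n)
    go (suc n) = ℚₚ.toℚᵘ-fromℚᵘ (ℚᵘ.mkℚᵘ (+ 1) n)
    le : ∀ n .{{_ : ℕ.NonZero n}} → (+ 1 ℚᵘ./ n) ℚᵘ.≤ ℚ.toℚᵘ 1ℚ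
    le (suc n) = ℚᵘ.*≤* (ℤ.+≤+ (ℕ.s≤s ℕ.z≤n))

  R-anti : ∀ {j k} → j ℕ.≤ k → R k ≤ R j
  R-anti {j} {k} j≤k = begin
    R k                    ≡⟨ cong R (ℕₚ.m+[n∸m]≡n j≤k) ⟨
    R (j ℕ.+ (k ℕ.∸ j))    ≡⟨ R-+ j (k ℕ.∸ j) ⟩
    R j * R (k ℕ.∸ j)      ≤⟨ ℚₚ.*-monoˡ-≤-nonNeg (R j) {{ℚₚ.pos⇒nonNeg (R j) {{R-pos j}}}} (R≤1 (k ℕ.∸ j)) ⟩
    R j * 1ℚ               ≡⟨ ℚₚ.*-identityʳ (R j) ⟩
    R j                    ∎
    where open ℚₚ.≤-Reasoning

  N≡R : ∀ n → n ≢ 0 → N n ≡ R (valuation p n)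
  N≡R zero    n≢0 = contradiction refl n≢0
  N≡R (suc n) n≢0 = refl

  N-nonNeg : ∀ n → ℚ.NonNegative (N n)
  N-nonNeg zero      = _
  N-nonNeg n@(suc _) = ℚₚ.pos⇒nonNeg (N n) {{R-pos (valuation p n)}}

  N-pos : ∀ n .{{_ : ℕ.NonZero n}} → ℚ.Positive (N n)
  N-pos n@(suc _) = R-pos (valuation p n)

  N-* : ∀ m n → N (m ℕ.* n) ≡ N m * N n
  N-* zero      n = sym (ℚₚ.*-zeroˡ (N n))
  N-* m@(suc _) zero = trans (cong N (ℕₚ.*-zeroʳ m)) (sym (ℚₚ.*-zeroʳ (N m)))
  N-* m@(suc _) n@(suc _) = trans (cong R (valuation-* m n (λ ()) (λ ()))) (R-+ (valuation p m) (valuation p n))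

  N-ultra : ∀ i j → N ℤ.∣ i ℤ.+ j ∣ ≤ N ℤ.∣ i ∣ ⊎ N ℤ.∣ i ℤ.+ j ∣ ≤ N ℤ.∣ j ∣
  N-ultra i j with ℤ.∣ i ℤ.+ j ∣ ℕ.≟ 0 | ℤ.∣ i ∣ ℕ.≟ 0 | ℤ.∣ j ∣ ℕ.≟ 0
  ... | yes e | _ | _ = inj₁ (subst (λ n → N n ≤ N ℤ.∣ i ∣) (sym e) (ℚₚ.nonNegative⁻¹ (N ℤ.∣ i ∣) {{N-nonNeg ℤ.∣ i ∣}}))
  ... | no _ | yes e | _ = inj₂ (ℚₚ.≤-reflexive (cong (λ t → N ℤ.∣ t ∣)
          (trans (cong (ℤ._+ j) (ℤₚ.∣i∣≡0⇒i≡0 {i} e)) (ℤₚ.+-identityˡ j))))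
  ... | no _ | no _ | yes e = inj₁ (ℚₚ.≤-reflexive (cong (λ t → N ℤ.∣ t ∣)
          (trans (cong (λ t → i ℤ.+ t) (ℤₚ.∣i∣≡0⇒i≡0 {j} e)) (ℤₚ.+-identityʳ i))))
  ... | no s≢0 | no i≢0 | no j≢0 = [ (λ a≤b → inj₁ (go {ℤ.∣ i ∣} i≢0 (divs (^valuation∣ ℤ.∣ i ∣ i≢0)
              (ℕ∣.∣-trans (^-mono-∣ a≤b) (^valuation∣ ℤ.∣ j ∣ j≢0)))))
          , (λ b≤a → inj₂ (go {ℤ.∣ j ∣} j≢0 (divs (ℕ∣.∣-trans (^-mono-∣ b≤a) (^valuation∣ ℤ.∣ i ∣ i≢0))
              (^valuation∣ ℤ.∣ j ∣ j≢0)))) ]′ (ℕₚ.≤-total (valuation p ℤ.∣ i ∣) (valuation p ℤ.∣ j ∣))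
    where
    divs : ∀ {d} → d ∣ ℤ.∣ i ∣ → d ∣ ℤ.∣ j ∣ → d ∣ ℤ.∣ i ℤ.+ j ∣
    divs {d} d∣i d∣j = ℤ∣.∣⇒∣ᵤ {+ d} {i ℤ.+ j} (ℤ∣.∣m∣n⇒∣m+n (ℤ∣.∣ᵤ⇒∣ {+ d} {i} d∣i) (ℤ∣.∣ᵤ⇒∣ {+ d} {j} d∣j))
    go : ∀ {n} → n ≢ 0 → p ℕ.^ valuation p n ∣ ℤ.∣ i ℤ.+ j ∣ → N ℤ.∣ i ℤ.+ j ∣ ≤ N n
    go {n} n≢0 d = begin
      N ℤ.∣ i ℤ.+ j ∣                  ≡⟨ N≡R ℤ.∣ i ℤ.+ j ∣ s≢0 ⟩
      R (valuation p ℤ.∣ i ℤ.+ j ∣)    ≤⟨ R-anti (^∣⇒≤valuation (valuation p n) ℤ.∣ i ℤ.+ j ∣ s≢0 d) ⟩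
      R (valuation p n)                ≡⟨ N≡R n n≢0 ⟨
      N n                              ∎
      where open ℚₚ.≤-Reasoning

  A : ℚ → ℚ
  A = padicAbs p

  A*N↧ : ∀ q → A q * N (↧ₙ q) ≡ N ℤ.∣ ↥ q ∣
  A*N↧ q = begin
    N ℤ.∣ ↥ q ∣ * P v * N (↧ₙ q)     ≡⟨ cong (N ℤ.∣ ↥ q ∣ * P v *_) (N≡R (↧ₙ q) λ ()) ⟩
    N ℤ.∣ ↥ q ∣ * P v * R v          ≡⟨ ℚₚ.*-assoc (N ℤ.∣ ↥ q ∣) (P v) (R v) ⟩
    N ℤ.∣ ↥ q ∣ * (P v * R v)        ≡⟨ cong (N ℤ.∣ ↥ q ∣ *_) (trans (ℚₚ.*-comm (P v) (R v)) (R*P v)) ⟩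
    N ℤ.∣ ↥ q ∣ * 1ℚ                 ≡⟨ ℚₚ.*-identityʳ _ ⟩
    N ℤ.∣ ↥ q ∣                      ∎
    where
    open ≡-Reasoning
    v = valuation p (↧ₙ q)

  *-cancelʳ-pos : ∀ r .{{_ : ℚ.Positive r}} {x y} → x * r ≡ y * r → x ≡ y
  *-cancelʳ-pos r eq = ℚₚ.≤-antisym
    (ℚₚ.*-cancelʳ-≤-pos r (ℚₚ.≤-reflexive eq))
    (ℚₚ.*-cancelʳ-≤-pos r (ℚₚ.≤-reflexive (sym eq)))

  A-fraction : ∀ q m d → .{{_ : ℕ.NonZero d}} → ↥ q ℤ.* + d ≡ m ℤ.* ↧ q → A q * N d ≡ N ℤ.∣ m ∣
  A-fraction q m d eq = *-cancelʳ-pos (N (↧ₙ q)) {{N-pos (↧ₙ q)}} (begin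
    A q * N d * N (↧ₙ q)         ≡⟨ solve 3 (λ a b c → a :* b :* c := a :* c :* b) refl (A q) (N d) (N (↧ₙ q)) ⟩
    A q * N (↧ₙ q) * N d         ≡⟨ cong (_* N d) (A*N↧ q) ⟩
    N ℤ.∣ ↥ q ∣ * N d            ≡⟨ N-* ℤ.∣ ↥ q ∣ d ⟨
    N (ℤ.∣ ↥ q ∣ ℕ.* d)          ≡⟨ cong N (trans (sym (ℤₚ.abs-* (↥ q) (+ d))) (trans (cong ℤ.∣_∣ eq) (ℤₚ.abs-* m (↧ q)))) ⟩
    N (ℤ.∣ m ∣ ℕ.* ↧ₙ q)         ≡⟨ N-* ℤ.∣ m ∣ (↧ₙ q) ⟩
    N ℤ.∣ m ∣ * N (↧ₙ q)         ∎)
    where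
    open ≡-Reasoning
    open +-*-Solver

  A-nonNeg : ∀ x → 0ℚ ≤ A x
  A-nonNeg x = ℚₚ.nonNegative⁻¹ (A x) {{ℚₚ.nonNeg*nonNeg⇒nonNeg (N ℤ.∣ ↥ x ∣) {{N-nonNeg ℤ.∣ ↥ x ∣}}
    (P v) {{ℚₚ.pos⇒nonNeg (P v) {{P-pos v}}}}}}
    where v = valuation p (↧ₙ x)

  A-definite : ∀ x → A x ≡ 0ℚ → x ≡ 0ℚ
  A-definite x e = ℚₚ.↥p≡0⇒p≡0 x (ℤₚ.∣i∣≡0⇒i≡0 (N0 ℤ.∣ ↥ x ∣ (trans (sym (A*N↧ x)) (trans (cong (_* N (↧ₙ x)) e) (ℚₚ.*-zeroˡ (N (↧ₙ x)))))))
    where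
    N0 : ∀ n → N n ≡ 0ℚ → n ≡ 0
    N0 zero    _ = refl
    N0 n@(suc _) e = ⊥-elim (ℚₚ.<⇒≢ (ℚₚ.positive⁻¹ (N n) {{N-pos n}}) (sym e))

  A-neg : ∀ x → A (- x) ≡ A x
  A-neg x@record{} = cong₂ (λ m d → N m * P (valuation p d))
    (trans (cong ℤ.∣_∣ (ℚₚ.↥-neg x)) (ℤₚ.∣-i∣≡∣i∣ (↥ x))) (ℤₚ.+-injective (ℚₚ.↧-neg x))

  cross : ∀ q {r} → ℚ.toℚᵘ q ℚᵘ.≃ r → ↥ q ℤ.* ℚᵘ.↧ r ≡ ℚᵘ.↥ r ℤ.* ↧ q
  cross (ℚ.mkℚ _ _ _) = ℚᵘₚ.drop-*≡*

  A-* : ∀ x y → A (x * y) ≡ A x * A y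
  A-* x@record{} y@record{} = *-cancelʳ-pos (N d) {{N-pos d}} (begin
    A (x * y) * N d                              ≡⟨ A-fraction (x * y) (↥ x ℤ.* ↥ y) d fr ⟩
    N ℤ.∣ ↥ x ℤ.* ↥ y ∣                          ≡⟨ cong N (ℤₚ.abs-* (↥ x) (↥ y)) ⟩
    N (ℤ.∣ ↥ x ∣ ℕ.* ℤ.∣ ↥ y ∣)                  ≡⟨ N-* ℤ.∣ ↥ x ∣ ℤ.∣ ↥ y ∣ ⟩
    N ℤ.∣ ↥ x ∣ * N ℤ.∣ ↥ y ∣                    ≡⟨ cong₂ _*_ (A*N↧ x) (A*N↧ y) ⟨
    A x * N (↧ₙ x) * (A y * N (↧ₙ y))            ≡⟨ solve 4 (λ a b c e → a :* b :* (c :* e) := a :* c :* (b :* e)) refl (A x) (N (↧ₙ x)) (A y) (N (↧ₙ y)) ⟩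
    A x * A y * (N (↧ₙ x) * N (↧ₙ y))            ≡⟨ cong (A x * A y *_) (N-* (↧ₙ x) (↧ₙ y)) ⟨
    A x * A y * N d                              ∎)
    where
    open ≡-Reasoning
    open +-*-Solver
    d = ↧ₙ x ℕ.* ↧ₙ y
    fr : ↥ (x * y) ℤ.* + d ≡ (↥ x ℤ.* ↥ y) ℤ.* ↧ (x * y)
    fr = cross (x * y) (ℚₚ.toℚᵘ-homo-* x y)

  A-ultra : ∀ x y → A (x + y) ≤ A x ⊎ A (x + y) ≤ A y
  A-ultra x@record{} y@record{} = [ (λ le → inj₁ (fin x (↥ x ℤ.* ↧ y) (trans (ℤₚ.*-assoc (↥ x) (↧ y) (↧ x)) (cong (↥ x ℤ.*_) (ℤₚ.*-comm (↧ y) (↧ x)))) le))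
                 , (λ le → inj₂ (fin y (↥ y ℤ.* ↧ x) (ℤₚ.*-assoc (↥ y) (↧ x) (↧ y)) le)) ]′
                 (N-ultra (↥ x ℤ.* ↧ y) (↥ y ℤ.* ↧ x))
    where
    d = ↧ₙ x ℕ.* ↧ₙ y
    m = ↥ x ℤ.* ↧ y ℤ.+ ↥ y ℤ.* ↧ x
    fr : ↥ (x + y) ℤ.* + d ≡ m ℤ.* ↧ (x + y)
    fr = cross (x + y) (ℚₚ.toℚᵘ-homo-+ x y)
    fin : ∀ z k → k ℤ.* ↧ z ≡ ↥ z ℤ.* + d → N ℤ.∣ m ∣ ≤ N ℤ.∣ k ∣ → A (x + y) ≤ A z
    fin z k eq le = ℚₚ.*-cancelʳ-≤-pos (N d) {{N-pos d}} (begin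
      A (x + y) * N d    ≡⟨ A-fraction (x + y) m d fr ⟩
      N ℤ.∣ m ∣          ≤⟨ le ⟩
      N ℤ.∣ k ∣          ≡⟨ A-fraction z k d (sym eq) ⟨
      A z * N d          ∎)
      where open ℚₚ.≤-Reasoning

  A-+ : ∀ x y → A (x + y) ≤ A x + A y
  A-+ x y = [ (λ le → ℚₚ.≤-trans le (subst (_≤ A x + A y) (ℚₚ.+-identityʳ (A x)) (ℚₚ.+-monoʳ-≤ (A x) (A-nonNeg y))))
            , (λ le → ℚₚ.≤-trans le (subst (_≤ A x + A y) (ℚₚ.+-identityˡ (A y)) (ℚₚ.+-monoˡ-≤ (A y) (A-nonNeg x)))) ]′ (A-ultra x y)

prime-recompute : ∀ p → .(Prime p) → Prime p
prime-recompute p pr = recompute (prime? p) pr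

padic : ∀ p → .(Prime p) → AbsoluteValue
padic p pr = record
  { abs          = padicAbs p {{prime⇒nonZero pr}}
  ; abs-nonNeg   = A-nonNeg
  ; abs-0        = ℚₚ.*-zeroˡ (+ (p ℕ.^ valuation p 1) / 1)
  ; abs-definite = A-definite
  ; abs-neg      = A-neg
  ; abs-*        = A-*
  ; abs-+        = A-+
  }
  where open PadicAbs p (prime-recompute p pr)

padic-ultrametric : ∀ p .(pr : Prime p) → let open AbsoluteValue (padic p pr) in
  ∀ x y → abs (x + y) ≤ abs x ⊎ abs (x + y) ≤ abs y
padic-ultrametric p pr = PadicAbs.A-ultra p (prime-recompute p pr)

Eventually : (ℕ → Set) → Set
Eventually Q = ∃[ N ] ∀ n → N ℕ.≤ n → Q n

eventually₂ : ∀ {Q R S : ℕ → Set} → (∀ n → Q n → R n → S n) →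
  Eventually Q → Eventually R → Eventually S
eventually₂ f (M , q) (N , r) = M ℕ.⊔ N , λ n le →
  f n (q n (ℕₚ.m⊔n≤o⇒m≤o M N le)) (r n (ℕₚ.m⊔n≤o⇒n≤o M N le))

eventually₁ : ∀ {Q R : ℕ → Set} → (∀ n → Q n → R n) → Eventually Q → Eventually R
eventually₁ f (M , q) = M , λ n le → f n (q n le)

half-pos : ∀ {ε} → 0ℚ < ε → 0ℚ < ½ * ε
half-pos {ε} 0<ε = ℚₚ.positive⁻¹ (½ * ε) {{ℚₚ.pos*pos⇒pos ½ ε {{ℚ.positive 0<ε}}}}

half+half : ∀ ε → ½ * ε + ½ * ε ≡ ε
half+half ε = trans (sym (ℚₚ.*-distribʳ-+ ε ½ ½)) (ℚₚ.*-identityˡ ε)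

module _ (V : AbsoluteValue) where

  open AbsoluteValue V

  IsCauchy : (ℕ → ℚ) → Set
  IsCauchy s = ∀ ε → 0ℚ < ε → ∃[ N ] ∀ m n → N ℕ.≤ m → N ℕ.≤ n → abs (s m - s n) < ε

  -- Points of the completion are Cauchy sequences themselves; equality is the
  -- relation _≈_ below.
  record Completion : Set where
    constructor cauchy
    field
      seq      : ℕ → ℚ
      isCauchy : IsCauchy seq

  open Completion public

module _ {V : AbsoluteValue} where

  open AbsoluteValue V

  infix 4 _≈_

  _≈_ : Completion V → Completion V → Set
  x ≈ y = ∀ ε → 0ℚ < ε → Eventually λ n → abs (seq x n - seq y n) < ε

  ≡⇒≈ : ∀ {x y} → (∀ n → seq x n ≡ seq y n) → x ≈ y
  ≡⇒≈ {x} {y} eq ε 0<ε = 0 , λ n _ → subst (_< ε)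
    (sym (trans (cong abs (trans (cong (_- seq y n) (eq n)) (ℚₚ.+-inverseʳ (seq y n)))) abs-0)) 0<ε

  abs-sub-comm : ∀ x y → abs (x - y) ≡ abs (y - x)
  abs-sub-comm x y = trans (cong abs (solve 2 (λ x y → x :- y := :- (y :- x)) refl x y)) (abs-neg (y - x))
    where open +-*-Solver

  split : ∀ {x y z} ε → abs x < ½ * ε → abs y < ½ * ε → z ≡ x + y → abs z < ε
  split {x} {y} {z} ε p q refl = begin-strict
    abs (x + y)      ≤⟨ abs-+ x y ⟩
    abs x + abs y    <⟨ ℚₚ.+-mono-< p q ⟩
    ½ * ε + ½ * ε    ≡⟨ half+half ε ⟩
    ε                ∎
    where open ℚₚ.≤-Reasoning

  ≈-sym : ∀ {x y} → x ≈ y → y ≈ x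
  ≈-sym {x} {y} x≈y ε 0<ε = eventually₁ (λ n → subst (_< ε) (abs-sub-comm (seq x n) (seq y n))) (x≈y ε 0<ε)

  ≈-trans : ∀ {x y z} → x ≈ y → y ≈ z → x ≈ z
  ≈-trans {x} {y} {z} x≈y y≈z ε 0<ε = eventually₂
    (λ n p q → split ε p q (solve 3 (λ x y z → x :- z := (x :- y) :+ (y :- z)) refl (seq x n) (seq y n) (seq z n)))
    (x≈y (½ * ε) (half-pos 0<ε)) (y≈z (½ * ε) (half-pos 0<ε))
    where open +-*-Solver

  ι : ℚ → Completion V
  ι q = cauchy (λ _ → q) λ ε 0<ε → 0 , λ _ _ _ _ →
    subst (_< ε) (sym (trans (cong abs (ℚₚ.+-inverseʳ q)) abs-0)) 0<ε

  sub-+ : ∀ a b c d → (a + b) - (c + d) ≡ (a - c) + (b - d)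
  sub-+ = solve 4 (λ a b c d → (a :+ b) :- (c :+ d) := (a :- c) :+ (b :- d)) refl
    where open +-*-Solver

  sub-neg : ∀ a b → (- a) - (- b) ≡ - (a - b)
  sub-neg = solve 2 (λ a b → (:- a) :- (:- b) := :- (a :- b)) refl
    where open +-*-Solver

  infixl 6 _+ᶜ_ _-ᶜ_
  infixl 7 _*ᶜ_
  infix  8 -ᶜ_

  _+ᶜ_ : Completion V → Completion V → Completion V
  (cauchy s cs) +ᶜ (cauchy t ct) = cauchy (λ n → s n + t n) λ ε 0<ε →
    let M , p = cs (½ * ε) (half-pos 0<ε)
        N , q = ct (½ * ε) (half-pos 0<ε)
    in M ℕ.⊔ N , λ m n le le′ → split ε
         (p m n (ℕₚ.m⊔n≤o⇒m≤o M N le) (ℕₚ.m⊔n≤o⇒m≤o M N le′))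
         (q m n (ℕₚ.m⊔n≤o⇒n≤o M N le) (ℕₚ.m⊔n≤o⇒n≤o M N le′))
         (sub-+ (s m) (t m) (s n) (t n))

  -ᶜ_ : Completion V → Completion V
  -ᶜ (cauchy s cs) = cauchy (λ n → - s n) λ ε 0<ε →
    let M , p = cs ε 0<ε
    in M , λ m n le le′ → subst (_< ε)
         (sym (trans (cong abs (sub-neg (s m) (s n))) (abs-neg (s m - s n)))) (p m n le le′)

  _-ᶜ_ : Completion V → Completion V → Completion V
  x -ᶜ y = x +ᶜ (-ᶜ y)

  bounded : (x : Completion V) → ∃[ B ] 0ℚ < B × Eventually (λ n → abs (seq x n) ≤ B)
  bounded (cauchy s cs) with cs 1ℚ (ℚₚ.positive⁻¹ 1ℚ)
  ... | N , p = B , 0<B , N , bd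
    where
    B = abs (s N) + 1ℚ
    0<B : 0ℚ < B
    0<B = ℚₚ.+-mono-≤-< (abs-nonNeg (s N)) (ℚₚ.positive⁻¹ 1ℚ)
    open ℚₚ.≤-Reasoning
    bd : ∀ n → N ℕ.≤ n → abs (s n) ≤ B
    bd n le = begin
      abs (s n)                      ≡⟨ cong abs (solve 2 (λ a b → a := b :+ (a :- b)) refl (s n) (s N)) ⟩
      abs (s N + (s n - s N))        ≤⟨ abs-+ (s N) (s n - s N) ⟩
      abs (s N) + abs (s n - s N)    ≤⟨ ℚₚ.+-monoʳ-≤ (abs (s N)) (ℚₚ.<⇒≤ (p n N le ℕₚ.≤-refl)) ⟩
      B                              ∎
      where open +-*-Solver using (solve; _:=_; _:+_; _:-_)

  scale : ∀ B → 0ℚ < B → ∀ ε → 0ℚ < ε → ∃[ δ ] 0ℚ < δ × B * δ ≡ ½ * ε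
  scale B 0<B ε 0<ε = ½ * ε * 1/B , 0<δ , eq
    where
    instance
      Bpos : ℚ.Positive B
      Bpos = ℚ.positive 0<B
      B≢0 : ℚ.NonZero B
      B≢0 = ℚₚ.pos⇒nonZero B
    1/B = 1/ B
    0<δ : 0ℚ < ½ * ε * 1/B
    0<δ = ℚₚ.positive⁻¹ (½ * ε * 1/B) {{ℚₚ.pos*pos⇒pos (½ * ε) {{ℚ.positive (half-pos 0<ε)}} 1/B {{ℚₚ.1/pos⇒pos B}}}}
    eq : B * (½ * ε * 1/B) ≡ ½ * ε
    eq = begin
      B * (½ * ε * 1/B)      ≡⟨ solve 3 (λ b e i → b :* (e :* i) := e :* (b :* i)) refl B (½ * ε) 1/B ⟩
      ½ * ε * (B * 1/B)      ≡⟨ cong (½ * ε *_) (ℚₚ.*-inverseʳ B) ⟩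
      ½ * ε * 1ℚ             ≡⟨ ℚₚ.*-identityʳ (½ * ε) ⟩
      ½ * ε                  ∎
      where
      open ≡-Reasoning
      open +-*-Solver

  product-small : ∀ {B δ a b} → 0ℚ < B → abs a ≤ B → abs b < δ → abs (a * b) < B * δ
  product-small {B} {δ} {a} {b} 0<B p q = begin-strict
    abs (a * b)      ≡⟨ abs-* a b ⟩
    abs a * abs b    ≤⟨ ℚₚ.*-monoʳ-≤-nonNeg (abs b) {{ℚ.nonNegative (abs-nonNeg b)}} p ⟩
    B * abs b        <⟨ ℚₚ.*-monoʳ-<-pos B {{ℚ.positive 0<B}} q ⟩
    B * δ            ∎
    where open ℚₚ.≤-Reasoning

  product-close : ∀ {Bx By δx δy ε a b c d} → 0ℚ < Bx → 0ℚ < By → Bx * δx ≡ ½ * ε → By * δy ≡ ½ * ε →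
    abs a ≤ Bx → abs d ≤ By → abs (a - c) < δy → abs (b - d) < δx → abs (a * b - c * d) < ε
  product-close {ε = ε} {a} {b} {c} {d} 0<Bx 0<By ex ey a≤ d≤ ac bd = split ε
    (subst (abs (a * (b - d)) <_) ex (product-small 0<Bx a≤ bd))
    (subst (abs (d * (a - c)) <_) ey (product-small 0<By d≤ ac))
    (solve 4 (λ a b c d → a :* b :- c :* d := a :* (b :- d) :+ d :* (a :- c)) refl a b c d)
    where open +-*-Solver

  _*ᶜ_ : Completion V → Completion V → Completion V
  x@(cauchy s cs) *ᶜ y@(cauchy t ct) = cauchy (λ n → s n * t n) λ ε 0<ε →
    let Bx , 0<Bx , Nx , bx = bounded x
        By , 0<By , Ny , by = bounded y
        δx , 0<δx , ex = scale Bx 0<Bx ε 0<ε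
        δy , 0<δy , ey = scale By 0<By ε 0<ε
        M , p = cs δy 0<δy
        N , q = ct δx 0<δx
        K = (Nx ℕ.⊔ Ny) ℕ.⊔ (M ℕ.⊔ N)
        l₁ : ∀ {k} → K ℕ.≤ k → (Nx ℕ.⊔ Ny) ℕ.≤ k
        l₁ = ℕₚ.m⊔n≤o⇒m≤o (Nx ℕ.⊔ Ny) (M ℕ.⊔ N)
        l₂ : ∀ {k} → K ℕ.≤ k → (M ℕ.⊔ N) ℕ.≤ k
        l₂ = ℕₚ.m⊔n≤o⇒n≤o (Nx ℕ.⊔ Ny) (M ℕ.⊔ N)
    in K , λ m n le le′ → product-close 0<Bx 0<By ex ey
         (bx m (ℕₚ.m⊔n≤o⇒m≤o Nx Ny (l₁ le)))
         (by n (ℕₚ.m⊔n≤o⇒n≤o Nx Ny (l₁ le′)))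
         (p m n (ℕₚ.m⊔n≤o⇒m≤o M N (l₂ le)) (ℕₚ.m⊔n≤o⇒m≤o M N (l₂ le′)))
         (q m n (ℕₚ.m⊔n≤o⇒n≤o M N (l₂ le)) (ℕₚ.m⊔n≤o⇒n≤o M N (l₂ le′)))

  +ᶜ-cong : ∀ {x x′ y y′} → x ≈ x′ → y ≈ y′ → (x +ᶜ y) ≈ (x′ +ᶜ y′)
  +ᶜ-cong {x} {x′} {y} {y′} p q ε 0<ε = eventually₂
    (λ n a b → split ε a b (sub-+ (seq x n) (seq y n) (seq x′ n) (seq y′ n)))
    (p (½ * ε) (half-pos 0<ε)) (q (½ * ε) (half-pos 0<ε))

  -ᶜ-cong : ∀ {x y} → x ≈ y → (-ᶜ x) ≈ (-ᶜ y)
  -ᶜ-cong {x} {y} p ε 0<ε = eventually₁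
    (λ n → subst (_< ε) (sym (trans (cong abs (sub-neg (seq x n) (seq y n))) (abs-neg (seq x n - seq y n)))))
    (p ε 0<ε)

  *ᶜ-cong : ∀ {x x′ y y′} → x ≈ x′ → y ≈ y′ → (x *ᶜ y) ≈ (x′ *ᶜ y′)
  *ᶜ-cong {x} {x′} {y} {y′} p q ε 0<ε =
    let Bx , 0<Bx , bx = bounded x
        By , 0<By , by = bounded y′
        δx , 0<δx , ex = scale Bx 0<Bx ε 0<ε
        δy , 0<δy , ey = scale By 0<By ε 0<ε
    in eventually₂ (λ n (a , d) (ac , bd) → product-close 0<Bx 0<By ex ey a d ac bd)
         (eventually₂ (λ _ → _,_) bx by) (eventually₂ (λ _ → _,_) (p δy 0<δy) (q δx 0<δx))

  ∣_∣ : Completion V → Completion archimedean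
  ∣ cauchy s cs ∣ = cauchy (λ n → abs (s n)) λ ε 0<ε →
    let M , p = cs ε 0<ε
    in M , λ m n le le′ → ℚₚ.≤-<-trans (reverse-triangle (s m) (s n)) (p m n le le′)
    where
    half-reverse : ∀ a b → abs a - abs b ≤ abs (a - b)
    half-reverse a b = begin
      abs a - abs b                     ≡⟨ cong (λ t → abs t - abs b) (solve 2 (λ a b → a := (a :- b) :+ b) refl a b) ⟩
      abs ((a - b) + b) - abs b         ≤⟨ ℚₚ.+-monoˡ-≤ (- abs b) (abs-+ (a - b) b) ⟩
      abs (a - b) + abs b - abs b       ≡⟨ solve 2 (λ a b → a :+ b :- b := a) refl (abs (a - b)) (abs b) ⟩
      abs (a - b)                       ∎
      where
      open ℚₚ.≤-Reasoning
      open +-*-Solver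
    reverse-triangle : ∀ a b → ℚ.∣ abs a - abs b ∣ ≤ abs (a - b)
    reverse-triangle a b with ℚₚ.∣p∣≡p∨∣p∣≡-p (abs a - abs b)
    ... | inj₁ e = subst (_≤ abs (a - b)) (sym e) (half-reverse a b)
    ... | inj₂ e = subst (_≤ abs (a - b)) (sym (trans e
            (solve 2 (λ x y → :- (x :- y) := y :- x) refl (abs a) (abs b))))
            (subst (abs b - abs a ≤_) (abs-sub-comm b a) (half-reverse b a))
      where open +-*-Solver

completionRing : AbsoluteValue → CommutativeRing 0ℓ 0ℓ
completionRing V = record
  { Carrier = Completion V
  ; _≈_     = _≈_
  ; _+_     = _+ᶜ_
  ; _*_     = _*ᶜ_
  ; -_      = -ᶜ_
  ; 0#      = ι 0ℚ
  ; 1#      = ι 1ℚ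
  ; isCommutativeRing = record
    { isRing = record
      { +-isAbelianGroup = record
        { isGroup = record
          { isMonoid = record
            { isSemigroup = record
              { isMagma = record
                { isEquivalence = record
                  { refl  = λ {x} → ≡⇒≈ {V} {x} {x} λ _ → refl
                  ; sym   = λ {x} {y} → ≈-sym {V} {x} {y}
                  ; trans = λ {x} {y} {z} → ≈-trans {V} {x} {y} {z}
                  }
                ; ∙-cong = λ {x} {y} {u} {v} → +ᶜ-cong {V} {x} {y} {u} {v}
                }
              ; assoc = λ x y z → ≡⇒≈ {V} {(x +ᶜ y) +ᶜ z} {x +ᶜ (y +ᶜ z)} λ n → ℚₚ.+-assoc (seq x n) (seq y n) (seq z n)
              }
            ; identity = (λ x → ≡⇒≈ {V} {ι 0ℚ +ᶜ x} {x} λ n → ℚₚ.+-identityˡ (seq x n))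
                       , (λ x → ≡⇒≈ {V} {x +ᶜ ι 0ℚ} {x} λ n → ℚₚ.+-identityʳ (seq x n))
            }
          ; inverse = (λ x → ≡⇒≈ {V} {(-ᶜ x) +ᶜ x} {ι 0ℚ} λ n → ℚₚ.+-inverseˡ (seq x n))
                    , (λ x → ≡⇒≈ {V} {x +ᶜ (-ᶜ x)} {ι 0ℚ} λ n → ℚₚ.+-inverseʳ (seq x n))
          ; ⁻¹-cong = λ {x} {y} → -ᶜ-cong {V} {x} {y}
          }
        ; comm = λ x y → ≡⇒≈ {V} {x +ᶜ y} {y +ᶜ x} λ n → ℚₚ.+-comm (seq x n) (seq y n)
        }
      ; *-cong     = λ {x} {y} {u} {v} → *ᶜ-cong {V} {x} {y} {u} {v}
      ; *-assoc    = λ x y z → ≡⇒≈ {V} {(x *ᶜ y) *ᶜ z} {x *ᶜ (y *ᶜ z)} λ n → ℚₚ.*-assoc (seq x n) (seq y n) (seq z n)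
      ; *-identity = (λ x → ≡⇒≈ {V} {ι 1ℚ *ᶜ x} {x} λ n → ℚₚ.*-identityˡ (seq x n))
                   , (λ x → ≡⇒≈ {V} {x *ᶜ ι 1ℚ} {x} λ n → ℚₚ.*-identityʳ (seq x n))
      ; distrib    = (λ x y z → ≡⇒≈ {V} {x *ᶜ (y +ᶜ z)} {(x *ᶜ y) +ᶜ (x *ᶜ z)} λ n → ℚₚ.*-distribˡ-+ (seq x n) (seq y n) (seq z n))
                   , (λ x y z → ≡⇒≈ {V} {(y +ᶜ z) *ᶜ x} {(y *ᶜ x) +ᶜ (z *ᶜ x)} λ n → ℚₚ.*-distribʳ-+ (seq x n) (seq y n) (seq z n))
      }
    ; *-comm = λ x y → ≡⇒≈ {V} {x *ᶜ y} {y *ᶜ x} λ n → ℚₚ.*-comm (seq x n) (seq y n)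
    }
  }

ℝ : Set
ℝ = Completion archimedean

infix 4 _<ᴿ_ _≤ᴿ_

-- Strict inequality asks for a rational gap: eventual termwise strictness would
-- allow equal limits.
_<ᴿ_ : ℝ → ℝ → Set
x <ᴿ y = ∃[ ε ] 0ℚ < ε × Eventually λ n → seq x n + ε ≤ seq y n

_≤ᴿ_ : ℝ → ℝ → Set
x ≤ᴿ y = ∀ ε → 0ℚ < ε → Eventually λ n → seq x n ≤ seq y n + ε

ℚ[_] : ∀ p → .(Prime p) → Set
ℚ[ p ] pr = Completion (padic p pr)

module _ (p : ℕ) .(pr : Prime p) where

  open AbsoluteValue (padic p pr)

  IsPadicInteger : ℚ[ p ] pr → Set
  IsPadicInteger x = ∣ x ∣ ≤ᴿ ι 1ℚ

  -- A unit of the ring of p-adic integers, not merely of the field.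
  IsPadicUnit : ℚ[ p ] pr → Set
  IsPadicUnit x = IsPadicInteger x × ∃[ y ] IsPadicInteger y × x *ᶜ y ≈ ι 1ℚ

  isPadicInteger-ι : ∀ q → abs q ≤ 1ℚ → IsPadicInteger (ι q)
  isPadicInteger-ι q le ε 0<ε = 0 , λ _ _ → ℚₚ.≤-trans le
    (subst (_≤ 1ℚ + ε) (ℚₚ.+-identityʳ 1ℚ) (ℚₚ.+-monoʳ-≤ 1ℚ (ℚₚ.<⇒≤ 0<ε)))

  isPadicInteger-0 : IsPadicInteger (ι 0ℚ)
  isPadicInteger-0 = isPadicInteger-ι 0ℚ (subst (_≤ 1ℚ) (sym abs-0) (ℚₚ.<⇒≤ (ℚₚ.positive⁻¹ 1ℚ)))

  isPadicInteger-1 : IsPadicInteger (ι 1ℚ)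
  isPadicInteger-1 = isPadicInteger-ι 1ℚ (ℚₚ.≤-reflexive abs-1)
    where
    1≢0 : abs 1ℚ ≢ 0ℚ
    1≢0 e with abs-definite 1ℚ e
    ... | ()
    abs-1 : abs 1ℚ ≡ 1ℚ
    abs-1 = begin
      abs 1ℚ                        ≡⟨ ℚₚ.*-identityʳ (abs 1ℚ) ⟨
      abs 1ℚ * 1ℚ                   ≡⟨ cong (abs 1ℚ *_) (ℚₚ.*-inverseʳ (abs 1ℚ)) ⟨
      abs 1ℚ * (abs 1ℚ * i)         ≡⟨ ℚₚ.*-assoc (abs 1ℚ) (abs 1ℚ) i ⟨
      abs 1ℚ * abs 1ℚ * i           ≡⟨ cong (_* i) (abs-* 1ℚ 1ℚ) ⟨
      abs 1ℚ * i                    ≡⟨ ℚₚ.*-inverseʳ (abs 1ℚ) ⟩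
      1ℚ                            ∎
      where
      open ≡-Reasoning
      instance
        nz : ℚ.NonZero (abs 1ℚ)
        nz = ℚ.≢-nonZero 1≢0
      i = 1/ abs 1ℚ

  isPadicInteger-neg : ∀ {x} → IsPadicInteger x → IsPadicInteger (-ᶜ x)
  isPadicInteger-neg {x} h ε 0<ε = eventually₁ (λ n → subst (_≤ 1ℚ + ε) (sym (abs-neg (seq x n)))) (h ε 0<ε)

  isPadicInteger-+ : ∀ {x y} → IsPadicInteger x → IsPadicInteger y → IsPadicInteger (x +ᶜ y)
  isPadicInteger-+ {x} {y} h k ε 0<ε = eventually₂
    (λ n a b → [ (λ le → ℚₚ.≤-trans le a) , (λ le → ℚₚ.≤-trans le b) ]′
      (padic-ultrametric p pr (seq x n) (seq y n))) (h ε 0<ε) (k ε 0<ε)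

  isPadicInteger-* : ∀ {x y} → IsPadicInteger x → IsPadicInteger y → IsPadicInteger (x *ᶜ y)
  isPadicInteger-* {x} {y} h k ε 0<ε = eventually₂ {λ n → abs (seq x n) ≤ 1ℚ + δ}
    {λ n → abs (seq y n) ≤ 1ℚ + 1ℚ × abs (seq y n) ≤ 1ℚ + ½ * ε} {λ n → abs (seq x n * seq y n) ≤ 1ℚ + ε}
    (λ n a (b , c) → go (seq x n) (seq y n) a b c)
    (h δ 0<δ) (eventually₂ (λ _ b c → b , c) (k 1ℚ (ℚₚ.positive⁻¹ 1ℚ)) (k (½ * ε) (half-pos 0<ε)))
    where
    δ = ½ * (½ * ε)
    0<δ : 0ℚ < δ
    0<δ = half-pos (half-pos 0<ε)
    go : ∀ a b → abs a ≤ 1ℚ + δ → abs b ≤ 1ℚ + 1ℚ → abs b ≤ 1ℚ + ½ * ε → abs (a * b) ≤ 1ℚ + ε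
    go a b p q r = begin
      abs (a * b)                      ≡⟨ abs-* a b ⟩
      abs a * abs b                    ≤⟨ ℚₚ.*-monoʳ-≤-nonNeg (abs b) {{ℚ.nonNegative (abs-nonNeg b)}} p ⟩
      (1ℚ + δ) * abs b                 ≡⟨ trans (ℚₚ.*-distribʳ-+ (abs b) 1ℚ δ) (cong (_+ δ * abs b) (ℚₚ.*-identityˡ (abs b))) ⟩
      abs b + δ * abs b                ≤⟨ ℚₚ.+-mono-≤ r (ℚₚ.*-monoˡ-≤-nonNeg δ {{ℚ.nonNegative (ℚₚ.<⇒≤ 0<δ)}} q) ⟩
      (1ℚ + ½ * ε) + δ * (1ℚ + 1ℚ)     ≡⟨ cong (λ t → (1ℚ + ½ * ε) + t) (trans (ℚₚ.*-distribˡ-+ δ 1ℚ 1ℚ)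
                                            (trans (cong₂ _+_ (ℚₚ.*-identityʳ δ) (ℚₚ.*-identityʳ δ)) (half+half (½ * ε)))) ⟩
      (1ℚ + ½ * ε) + ½ * ε             ≡⟨ trans (ℚₚ.+-assoc 1ℚ (½ * ε) (½ * ε)) (cong (λ t → 1ℚ + t) (half+half ε)) ⟩
      1ℚ + ε                           ∎
      where open ℚₚ.≤-Reasoning

-- The primality proof is irrelevant, so there is exactly one place per prime.
data Place : Set where
  ∞      : Place
  finite : ∀ p → .(Prime p) → Place

absoluteValueAt : Place → AbsoluteValue
absoluteValueAt ∞             = archimedean
absoluteValueAt (finite p pr) = padic p pr

ℚ⟨_⟩ : Place → Set
ℚ⟨ v ⟩ = Completion (absoluteValueAt v)

PlaceSequence : Set
PlaceSequence = ∀ v → ℚ⟨ v ⟩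

-- The list S contains the finitely many exceptional primes.
IsAdele : PlaceSequence → Set
IsAdele x = ∃[ S ] ∀ p .(pr : Prime p) → p ∉ S → IsPadicInteger p pr (x (finite p pr))

Adele : Set
Adele = Σ PlaceSequence IsAdele

zeroAdele oneAdele : Adele
zeroAdele = (λ v → ι 0ℚ) , [] , λ p pr _ → isPadicInteger-0 p pr
oneAdele  = (λ v → ι 1ℚ) , [] , λ p pr _ → isPadicInteger-1 p pr

negAdele : Adele → Adele
negAdele (x , S , h) = (λ v → -ᶜ x v) , S , λ p pr p∉ → isPadicInteger-neg p pr {x (finite p pr)} (h p pr p∉)

addAdele mulAdele : Adele → Adele → Adele
addAdele (x , S , h) (y , T , k) = (λ v → x v +ᶜ y v) , S ++ T , λ p pr p∉ →
  isPadicInteger-+ p pr {x (finite p pr)} {y (finite p pr)} (h p pr (p∉ ∘ ∈-++⁺ˡ)) (k p pr (p∉ ∘ ∈-++⁺ʳ S))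
mulAdele (x , S , h) (y , T , k) = (λ v → x v *ᶜ y v) , S ++ T , λ p pr p∉ →
  isPadicInteger-* p pr {x (finite p pr)} {y (finite p pr)} (h p pr (p∉ ∘ ∈-++⁺ˡ)) (k p pr (p∉ ∘ ∈-++⁺ʳ S))

adeleRing : CommutativeRing 0ℓ 0ℓ
adeleRing = record
  { Carrier = Adele
  ; _≈_     = λ x y → ∀ v → proj₁ x v ≈ proj₁ y v
  ; _+_     = addAdele
  ; _*_     = mulAdele
  ; -_      = negAdele
  ; 0#      = zeroAdele
  ; 1#      = oneAdele
  ; isCommutativeRing = record
    { isRing = record
      { +-isAbelianGroup = record
        { isGroup = record
          { isMonoid = record
            { isSemigroup = record
              { isMagma = record
                { isEquivalence = record
                  { refl  = λ {x} v → K.refl v {proj₁ x v}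
                  ; sym   = λ {x} {y} p v → K.sym v {proj₁ x v} {proj₁ y v} (p v)
                  ; trans = λ {x} {y} {z} p q v → K.trans v {proj₁ x v} {proj₁ y v} {proj₁ z v} (p v) (q v)
                  }
                ; ∙-cong = λ {x} {y} {z} {w} p q v →
                    K.+-cong v {proj₁ x v} {proj₁ y v} {proj₁ z v} {proj₁ w v} (p v) (q v)
                }
              ; assoc = λ x y z v → K.+-assoc v (proj₁ x v) (proj₁ y v) (proj₁ z v)
              }
            ; identity = (λ x v → K.+-identityˡ v (proj₁ x v)) , (λ x v → K.+-identityʳ v (proj₁ x v))
            }
          ; inverse = (λ x v → K.-‿inverseˡ v (proj₁ x v)) , (λ x v → K.-‿inverseʳ v (proj₁ x v))
          ; ⁻¹-cong = λ {x} {y} p v → K.-‿cong v {proj₁ x v} {proj₁ y v} (p v)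
          }
        ; comm = λ x y v → K.+-comm v (proj₁ x v) (proj₁ y v)
        }
      ; *-cong = λ {x} {y} {z} {w} p q v →
          K.*-cong v {proj₁ x v} {proj₁ y v} {proj₁ z v} {proj₁ w v} (p v) (q v)
      ; *-assoc = λ x y z v → K.*-assoc v (proj₁ x v) (proj₁ y v) (proj₁ z v)
      ; *-identity = (λ x v → K.*-identityˡ v (proj₁ x v)) , (λ x v → K.*-identityʳ v (proj₁ x v))
      ; distrib = (λ x y z v → K.distribˡ v (proj₁ x v) (proj₁ y v) (proj₁ z v))
                , (λ x y z v → K.distribʳ v (proj₁ x v) (proj₁ y v) (proj₁ z v))
      }
    ; *-comm = λ x y v → K.*-comm v (proj₁ x v) (proj₁ y v)
    }
  }
  where module K v = CommutativeRing (completionRing (absoluteValueAt v))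

IsIdele : PlaceSequence → Set
IsIdele x = Σ[ x∈𝔸 ∈ IsAdele x ] Invertible 𝔸._≈_ 𝔸.1# 𝔸._*_ (x , x∈𝔸)
  where module 𝔸 = CommutativeRing adeleRing

module _ {V : AbsoluteValue} where

  open Exp (CommutativeRing.semiring (completionRing V)) public using (_^_)

  infix 4 _⟶_

  _⟶_ : (ℕ → Completion V) → Completion V → Set
  s ⟶ l = ∀ ε → 0ℚ < ε → Eventually λ n → ∣ s n -ᶜ l ∣ <ᴿ ι ε

  partialSum : (ℕ → Completion V) → ℕ → Completion V
  partialSum t zero    = ι 0ℚ
  partialSum t (suc n) = partialSum t n +ᶜ t n

  HasSum : (ℕ → Completion V) → Completion V → Set
  HasSum t s = partialSum t ⟶ s

pochhammer : ℚ → ℕ → ℚ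
pochhammer a zero    = 1ℚ
pochhammer a (suc n) = pochhammer a n * (a + + n / 1)

NotNonPositiveInteger : ℚ → Set
NotNonPositiveInteger c = ∀ (n : ℕ) → c ≢ - (+ n / 1)

*-≢0 : ∀ {p q} → p ≢ 0ℚ → q ≢ 0ℚ → p * q ≢ 0ℚ
*-≢0 {p} {q} p≢0 q≢0 pq≡0 = q≢0 (begin
  q                  ≡⟨ ℚₚ.*-identityˡ q ⟨
  1ℚ * q             ≡⟨ cong (_* q) (ℚₚ.*-inverseˡ p) ⟨
  1/ p * p * q       ≡⟨ ℚₚ.*-assoc (1/ p) p q ⟩
  1/ p * (p * q)     ≡⟨ cong (1/ p *_) pq≡0 ⟩
  1/ p * 0ℚ          ≡⟨ ℚₚ.*-zeroʳ (1/ p) ⟩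
  0ℚ                 ∎)
  where
  open ≡-Reasoning
  instance
    p-nonZero : ℚ.NonZero p
    p-nonZero = ℚ.≢-nonZero p≢0

pochhammer-≢0 : ∀ {c} → NotNonPositiveInteger c → ∀ n → pochhammer c n ≢ 0ℚ
pochhammer-≢0     c∉ zero    = λ ()
pochhammer-≢0 {c} c∉ (suc n) = *-≢0 (pochhammer-≢0 c∉ n) λ c+n≡0 → c∉ n (begin
  c                              ≡⟨ solve 2 (λ c n → c := (c :+ n) :- n) refl c (+ n / 1) ⟩
  (c + + n / 1) - + n / 1        ≡⟨ cong (_- + n / 1) c+n≡0 ⟩
  0ℚ - + n / 1                   ≡⟨ ℚₚ.+-identityˡ (- (+ n / 1)) ⟩
  - (+ n / 1)                    ∎)
  where
  open ≡-Reasoning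
  open +-*-Solver

factorial-≢0 : ∀ n → + (n !) / 1 ≢ 0ℚ
factorial-≢0 n e = ℚₚ.<⇒≢ (ℚₚ.positive⁻¹ (+ (n !) / 1) {{ℚₚ.normalize-pos (n !) 1 {{_}} {{n ℕₚ.!≢0}}}}) (sym e)

hypergeometricCoefficient : (a b c : ℚ) → NotNonPositiveInteger c → ℕ → ℚ
hypergeometricCoefficient a b c c∉ n =
  ((pochhammer a n * pochhammer b n) ÷ (pochhammer c n * (+ (n !) / 1)))
    {{ℚ.≢-nonZero (*-≢0 (pochhammer-≢0 c∉ n) (factorial-≢0 n))}}

-- s is the sum F(a, b; c; x) in the completion containing x.
IsHypergeometricSum : (a b c : ℚ) → NotNonPositiveInteger c →
  {V : AbsoluteValue} → Completion V → Completion V → Set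
IsHypergeometricSum a b c c∉ x s = HasSum (λ n → ι (hypergeometricCoefficient a b c c∉ n) *ᶜ x ^ n) s

{-# OPTIONS --safe #-}
-- The hypothesis on a forces a = ±1, since no prime divides its numerator or
-- denominator.  As b = c, the series is Σ xⁿ = 1/(1 − x) for a = 1, and the
-- polynomial 1 − x for a = −1.  So it suffices that 1 − x is invertible at every
-- place, that the geometric series converges to the inverse, and that the inverse is
-- a p-adic integer for every p; the last holds since |x|ₚ < 1 gives |1 − x|ₚ ≥ 1.
module Submission where

open import Defs
open import Algebra.Bundles using (CommutativeRing)
import Algebra.Properties.Semiring.Exp as Exp
open import Data.Integer as ℤ using (+_; -[1+_])
import Data.Integer.Properties as ℤₚ
open import Data.List using ([]; _∷_)
open import Data.List.Relation.Unary.All using (_∷_)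
open import Data.Nat as ℕ using (ℕ; zero; suc; _!)
open import Data.Nat.Divisibility as ℕ∣ using (_∣_; _∤_; _∣?_)
import Data.Nat.Coprimality as Coprimality
open import Data.Nat.ListAction using (product)
open import Data.Nat.Primality using (Prime; prime[2])
open import Data.Nat.Primality.Factorisation using (factorise)
import Data.Nat.Properties as ℕₚ
open import Data.Product using (∃-syntax; _×_; _,_; proj₁; proj₂)
open import Data.Rational as ℚ
  using (ℚ; mkℚ; 0ℚ; 1ℚ; ½; _+_; _*_; _-_; -_; _<_; _≤_; _/_; ↥_; ↧ₙ_; 1/_)
import Data.Rational.Properties as ℚₚ
open import Data.Rational.Solver using (module +-*-Solver)
import Data.Rational.Unnormalised as ℚᵘ
import Data.Rational.Unnormalised.Properties as ℚᵘₚ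
open import Data.Sum using (_⊎_; inj₁; inj₂; [_,_]′)
open import Relation.Binary.PropositionalEquality
  using (_≡_; _≢_; refl; sym; trans; cong; cong₂; subst; subst₂; module ≡-Reasoning)
open import Relation.Nullary using (¬_; yes; no; contradiction)

open Exp (CommutativeRing.semiring ℚₚ.+-*-commutativeRing) using () renaming (_^_ to _^ℚ_)

-- Order on ℚ

0<1 : 0ℚ < 1ℚ
0<1 = ℚₚ.positive⁻¹ 1ℚ

*-pos : ∀ {p q} → 0ℚ < p → 0ℚ < q → 0ℚ < p * q
*-pos {p} {q} 0<p 0<q = ℚₚ.positive⁻¹ (p * q) {{ℚₚ.pos*pos⇒pos p {{ℚ.positive 0<p}} q {{ℚ.positive 0<q}}}}

*-nonNeg : ∀ {p q} → 0ℚ ≤ p → 0ℚ ≤ q → 0ℚ ≤ p * q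
*-nonNeg {p} {q} 0≤p 0≤q =
  ℚₚ.nonNegative⁻¹ (p * q) {{ℚₚ.nonNeg*nonNeg⇒nonNeg p {{ℚ.nonNegative 0≤p}} q {{ℚ.nonNegative 0≤q}}}}

*-monoˡ-≤ : ∀ {r p q} → 0ℚ ≤ r → p ≤ q → r * p ≤ r * q
*-monoˡ-≤ {r} 0≤r = ℚₚ.*-monoˡ-≤-nonNeg r {{ℚ.nonNegative 0≤r}}

*-monoʳ-≤ : ∀ {r p q} → 0ℚ ≤ r → p ≤ q → p * r ≤ q * r
*-monoʳ-≤ {r} 0≤r = ℚₚ.*-monoʳ-≤-nonNeg r {{ℚ.nonNegative 0≤r}}

*-cancelˡ-≤ : ∀ {r p q} → 0ℚ < r → r * p ≤ r * q → p ≤ q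
*-cancelˡ-≤ {r} 0<r = ℚₚ.*-cancelˡ-≤-pos r {{ℚ.positive 0<r}}

p≤p+q : ∀ {p q} → 0ℚ ≤ q → p ≤ p + q
p≤p+q {p} {q} 0≤q = subst (_≤ p + q) (ℚₚ.+-identityʳ p) (ℚₚ.+-monoʳ-≤ p 0≤q)

+-cancelʳ-≤ : ∀ {p q} r → p + r ≤ q + r → p ≤ q
+-cancelʳ-≤ {p} {q} r le = subst₂ _≤_ (lem p r) (lem q r) (ℚₚ.+-monoˡ-≤ (- r) le)
  where
  open +-*-Solver
  lem : ∀ p r → p + r - r ≡ p
  lem = solve 2 (λ p r → p :+ r :- r := p) refl

<⇒≱ : ∀ {p q} → p < q → ¬ (q ≤ p)
<⇒≱ p<q q≤p = ℚₚ.<-irrefl refl (ℚₚ.<-≤-trans p<q q≤p)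

-- If `p` exceeded `q`, slack equal to half of `p - q` would force that positive half to be at most
-- zero.
≤-from-slack : ∀ {p q} → (∀ ε → 0ℚ < ε → p ≤ q + ε) → p ≤ q
≤-from-slack {p} {q} slack with p ℚₚ.≤? q
... | yes p≤q = p≤q
... | no  p≰q = contradiction (+-cancelʳ-≤ (½ * (p - q)) half≤0) (<⇒≱ (half-pos 0<p-q))
  where
  open +-*-Solver
  open ℚₚ.≤-Reasoning
  0<p-q : 0ℚ < p - q
  0<p-q = subst (_< p - q) (ℚₚ.+-inverseʳ q) (ℚₚ.+-monoˡ-< (- q) (ℚₚ.≰⇒> p≰q))
  half≤0 : ½ * (p - q) + ½ * (p - q) ≤ 0ℚ + ½ * (p - q)
  half≤0 = begin
    ½ * (p - q) + ½ * (p - q)          ≡⟨ half+half (p - q) ⟩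
    p - q                              ≤⟨ ℚₚ.+-monoˡ-≤ (- q) (slack (½ * (p - q)) (half-pos 0<p-q)) ⟩
    q + ½ * (p - q) - q                ≡⟨ solve 2 (λ q h → q :+ h :- q := con 0ℚ :+ h) refl q (½ * (p - q)) ⟩
    0ℚ + ½ * (p - q)                   ∎

p≤½ε⇒p+½ε≤ε : ∀ {p} ε → p ≤ ½ * ε → p + ½ * ε ≤ ε
p≤½ε⇒p+½ε≤ε {p} ε le = subst (p + ½ * ε ≤_) (half+half ε) (ℚₚ.+-monoˡ-≤ (½ * ε) le)

p<p+q : ∀ {p q} → 0ℚ < q → p < p + q
p<p+q {p} {q} 0<q = subst (_< p + q) (ℚₚ.+-identityʳ p) (ℚₚ.+-monoʳ-< p 0<q)

1+n/1 : ∀ n → 1ℚ + + n / 1 ≡ + suc n / 1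
1+n/1 n = ℚₚ.toℚᵘ-injective (begin
  ℚ.toℚᵘ (1ℚ + + n / 1)                        ≈⟨ ℚₚ.toℚᵘ-homo-+ 1ℚ (+ n / 1) ⟩
  ℚ.toℚᵘ 1ℚ ℚᵘ.+ ℚ.toℚᵘ (+ n / 1)              ≈⟨ ℚᵘₚ.+-cong {ℚᵘ.1ℚᵘ} ℚᵘₚ.≃-refl (ℚₚ.toℚᵘ-fromℚᵘ (ℚᵘ.mkℚᵘ (+ n) 0)) ⟩
  ℚᵘ.1ℚᵘ ℚᵘ.+ ℚᵘ.mkℚᵘ (+ n) 0                  ≈⟨ 1+n≃suc-n ⟩
  ℚᵘ.mkℚᵘ (+ suc n) 0                          ≈⟨ ℚₚ.toℚᵘ-fromℚᵘ (ℚᵘ.mkℚᵘ (+ suc n) 0) ⟨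
  ℚ.toℚᵘ (+ suc n / 1)                         ∎)
  where
  open ℚᵘₚ.≃-Reasoning
  1+n≃suc-n : ℚᵘ.1ℚᵘ ℚᵘ.+ ℚᵘ.mkℚᵘ (+ n) 0 ℚᵘ.≃ ℚᵘ.mkℚᵘ (+ suc n) 0
  1+n≃suc-n = ℚᵘ.*≡* (cong (λ i → (+ 1 ℤ.+ i) ℤ.* + 1) (ℤₚ.*-identityʳ (+ n)))

-- An explicit Archimedean bound: a positive fraction has numerator at least 1, so multiplying by
-- anything from the denominator upwards reaches 1.
1≤n*q : ∀ {q} → 0ℚ < q → ∀ {n} → ↧ₙ q ℕ.≤ n → 1ℚ ≤ (+ n / 1) * q
1≤n*q {mkℚ -[1+ _ ] _ _} 0<q = contradiction (ℚ.positive 0<q) λ ()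
1≤n*q {mkℚ (+ zero) _ _} 0<q = contradiction (ℚ.positive 0<q) λ ()
1≤n*q {q@(mkℚ (+ suc k) d _)} 0<q {n} d<n = ℚₚ.toℚᵘ-cancel-≤ (begin
  ℚ.toℚᵘ 1ℚ                             ≤⟨ ℚᵘ.*≤* (subst₂ ℤ._≤_ eqˡ eqʳ (ℤ.+≤+ le)) ⟩
  ℚᵘ.mkℚᵘ (+ n) 0 ℚᵘ.* ℚ.toℚᵘ q         ≃⟨ ℚᵘₚ.*-congʳ {ℚ.toℚᵘ q} (ℚₚ.toℚᵘ-fromℚᵘ (ℚᵘ.mkℚᵘ (+ n) 0)) ⟨
  ℚ.toℚᵘ (+ n / 1) ℚᵘ.* ℚ.toℚᵘ q        ≃⟨ ℚₚ.toℚᵘ-homo-* (+ n / 1) q ⟨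
  ℚ.toℚᵘ ((+ n / 1) * q)                ∎)
  where
  open ℚᵘₚ.≤-Reasoning
  le : suc d ℕ.≤ n ℕ.* suc k
  le = ℕₚ.≤-trans d<n (ℕₚ.m≤m*n n (suc k))
  eqˡ : + suc d ≡ + 1 ℤ.* (+ 1 ℤ.* + suc d)
  eqˡ = sym (trans (ℤₚ.*-identityˡ _) (ℤₚ.*-identityˡ _))
  eqʳ : + (n ℕ.* suc k) ≡ + n ℤ.* + suc k ℤ.* + 1
  eqʳ = trans (ℤₚ.pos-* n (suc k)) (sym (ℤₚ.*-identityʳ _))

-- Bernoulli's inequality and vanishing powers

module _ {u ε : ℚ} (0≤u : 0ℚ ≤ u) (0≤ε : 0ℚ ≤ ε) (u+ε≤1 : u + ε ≤ 1ℚ) where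

  ^-nonNeg : ∀ n → 0ℚ ≤ u ^ℚ n
  ^-nonNeg zero    = ℚₚ.<⇒≤ 0<1
  ^-nonNeg (suc n) = *-nonNeg 0≤u (^-nonNeg n)

  -- Bernoulli's inequality (1 + ε)ⁿ ≥ 1 + nε, multiplied out since u (1 + ε) ≤ 1.
  bernoulli : ∀ n → u ^ℚ n * (1ℚ + (+ n / 1) * ε) ≤ 1ℚ
  bernoulli zero = ℚₚ.≤-reflexive (trans (ℚₚ.*-identityˡ _)
    (trans (cong (λ t → 1ℚ + t) (ℚₚ.*-zeroˡ ε)) (ℚₚ.+-identityʳ 1ℚ)))
  bernoulli (suc n) = begin
    u * w * (1ℚ + (+ suc n / 1) * ε)    ≡⟨ cong (λ k → u * w * (1ℚ + k * ε)) (1+n/1 n) ⟨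
    u * w * (1ℚ + (1ℚ + k) * ε)         ≡⟨ solve 4 (λ u w k ε → u :* w :* (con 1ℚ :+ (con 1ℚ :+ k) :* ε)
                                             := w :* (u :* (con 1ℚ :+ k :* ε) :+ u :* ε)) refl u w k ε ⟩
    w * (u * t + u * ε)                 ≤⟨ *-monoˡ-≤ (^-nonNeg n) (ℚₚ.+-monoʳ-≤ (u * t) (*-monoʳ-≤ 0≤ε u≤t)) ⟩
    w * (u * t + t * ε)                 ≡⟨ solve 4 (λ u w t ε → w :* (u :* t :+ t :* ε) := w :* t :* (u :+ ε)) refl u w t ε ⟩
    w * t * (u + ε)                     ≤⟨ *-monoˡ-≤ (*-nonNeg (^-nonNeg n) (ℚₚ.≤-trans (ℚₚ.<⇒≤ 0<1) 1≤t)) u+ε≤1 ⟩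
    w * t * 1ℚ                          ≡⟨ ℚₚ.*-identityʳ (w * t) ⟩
    w * t                               ≤⟨ bernoulli n ⟩
    1ℚ                                  ∎
    where
    open ℚₚ.≤-Reasoning
    open +-*-Solver
    w = u ^ℚ n
    k = + n / 1
    t = 1ℚ + k * ε
    1≤t : 1ℚ ≤ t
    1≤t = p≤p+q (*-nonNeg (ℚₚ.nonNegative⁻¹ k {{ℚₚ.normalize-nonNeg n 1}}) 0≤ε)
    u≤t : u ≤ t
    u≤t = ℚₚ.≤-trans (ℚₚ.≤-trans (p≤p+q 0≤ε) u+ε≤1) 1≤t

-- Bernoulli bounds `u ^ℚ n` times `n * ε` by 1, while `n * (ε * κ)` is at least 1 once `n` reaches
-- the denominator of `ε * κ`. The threshold is uniform in `u`, so one exponent serves all late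
-- terms of a Cauchy sequence at once.
^-vanishes : ∀ {ε κ} → 0ℚ < ε → 0ℚ < κ → ∃[ N ] ∀ n → N ℕ.≤ n → ∀ {u} → 0ℚ ≤ u → u + ε ≤ 1ℚ → u ^ℚ n ≤ κ
^-vanishes {ε} {κ} 0<ε 0<κ = ↧ₙ (ε * κ) , λ n le {u} 0≤u u+ε≤1 →
  let 0≤ε = ℚₚ.<⇒≤ 0<ε
      w   = u ^ℚ n
      0≤w = ^-nonNeg 0≤u 0≤ε u+ε≤1 n
      k   = + n / 1
  in begin
    w                         ≡⟨ ℚₚ.*-identityʳ w ⟨
    w * 1ℚ                    ≤⟨ *-monoˡ-≤ 0≤w (1≤n*q (*-pos 0<ε 0<κ) le) ⟩
    w * (k * (ε * κ))         ≡⟨ solve 4 (λ w k ε κ → w :* (k :* (ε :* κ)) := w :* (k :* ε) :* κ) refl w k ε κ ⟩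
    w * (k * ε) * κ           ≤⟨ *-monoʳ-≤ (ℚₚ.<⇒≤ 0<κ) (*-monoˡ-≤ 0≤w (subst (k * ε ≤_) (ℚₚ.+-comm (k * ε) 1ℚ) (p≤p+q (ℚₚ.<⇒≤ 0<1)))) ⟩
    w * (1ℚ + k * ε) * κ      ≤⟨ *-monoʳ-≤ (ℚₚ.<⇒≤ 0<κ) (bernoulli 0≤u 0≤ε u+ε≤1 n) ⟩
    1ℚ * κ                    ≡⟨ ℚₚ.*-identityˡ κ ⟩
    κ                         ∎
  where
  open ℚₚ.≤-Reasoning
  open +-*-Solver

-- Total inverse with the junk value 0 at 0.
recip : ℚ → ℚ
recip q with q ℚ.≟ 0ℚ
... | yes _   = 0ℚ
... | no  q≢0 = (1/ q) {{ℚ.≢-nonZero q≢0}}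

*-recip : ∀ {q} → q ≢ 0ℚ → q * recip q ≡ 1ℚ
*-recip {q} q≢0 with q ℚ.≟ 0ℚ
... | yes q≡0 = contradiction q≡0 q≢0
... | no  ne  = ℚₚ.*-inverseʳ q {{ℚ.≢-nonZero ne}}

-- Limits in a completion

module _ {V : AbsoluteValue} where

  open AbsoluteValue V

  -- Multiplicativity makes `abs 1ℚ` idempotent, and definiteness makes it positive, so it cancels.
  abs-1 : abs 1ℚ ≡ 1ℚ
  abs-1 = ℚₚ.≤-antisym
    (*-cancelˡ-≤ 0<abs-1 (ℚₚ.≤-reflexive square))
    (*-cancelˡ-≤ 0<abs-1 (ℚₚ.≤-reflexive (sym square)))
    where
    0<abs-1 : 0ℚ < abs 1ℚ
    0<abs-1 = ℚₚ.≰⇒> λ le → contradiction (abs-definite 1ℚ (ℚₚ.≤-antisym le (abs-nonNeg 1ℚ))) λ ()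
    square : abs 1ℚ * abs 1ℚ ≡ abs 1ℚ * 1ℚ
    square = trans (sym (abs-* 1ℚ 1ℚ)) (sym (ℚₚ.*-identityʳ (abs 1ℚ)))

  abs-^ : ∀ q n → abs (q ^ℚ n) ≡ abs q ^ℚ n
  abs-^ q zero    = abs-1
  abs-^ q (suc n) = trans (abs-* q (q ^ℚ n)) (cong (abs q *_) (abs-^ q n))

  seq-^ : ∀ (x : Completion V) n m → seq (x ^ n) m ≡ seq x m ^ℚ n
  seq-^ x zero    m = refl
  seq-^ x (suc n) m = cong (seq x m *_) (seq-^ x n m)

  powerSeriesTerm : (ℕ → ℚ) → Completion V → ℕ → Completion V
  powerSeriesTerm k x n = ι (k n) *ᶜ x ^ n

  ∣-∣≤-cong : ∀ {x y : Completion V} q → x ≈ y → ∣ x ∣ ≤ᴿ ι q → ∣ y ∣ ≤ᴿ ι q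
  ∣-∣≤-cong {x} {y} q x≈y ∣x∣≤q ε 0<ε = eventually₂
    (λ n near le → begin
      abs (seq y n)                                ≡⟨ cong abs (solve 2 (λ x y → y := x :+ :- (x :- y)) refl (seq x n) (seq y n)) ⟩
      abs (seq x n + - (seq x n - seq y n))        ≤⟨ abs-+ (seq x n) (- (seq x n - seq y n)) ⟩
      abs (seq x n) + abs (- (seq x n - seq y n))  ≡⟨ cong (λ t → abs (seq x n) + t) (abs-neg (seq x n - seq y n)) ⟩
      abs (seq x n) + abs (seq x n - seq y n)      ≤⟨ ℚₚ.+-mono-≤ le (ℚₚ.<⇒≤ near) ⟩
      q + ½ * ε + ½ * ε                            ≡⟨ trans (ℚₚ.+-assoc q (½ * ε) (½ * ε)) (cong (λ t → q + t) (half+half ε)) ⟩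
      q + ε                                        ∎)
    (x≈y (½ * ε) (half-pos 0<ε)) (∣x∣≤q (½ * ε) (half-pos 0<ε))
    where
    open ℚₚ.≤-Reasoning
    open +-*-Solver

  -- In the limit 1 = |q||y| ≤ |q|. Since `y` is only a Cauchy sequence, |y| ≤ 1 and qy = 1 are each
  -- used with an error of ε/2, and |q| ≤ 1 keeps the total error within ε.
  abs-unit : ∀ q (y : Completion V) → ∣ ι {V} q ∣ ≤ᴿ ι 1ℚ → ∣ y ∣ ≤ᴿ ι 1ℚ → ι q *ᶜ y ≈ ι 1ℚ → abs q ≡ 1ℚ
  abs-unit q y ∣q∣≤1 ∣y∣≤1 qy≈1 = ℚₚ.≤-antisym abs≤1 (≤-from-slack 1≤abs+ε)
    where
    open ℚₚ.≤-Reasoning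
    open +-*-Solver
    abs≤1 : abs q ≤ 1ℚ
    -- The sequence of `ι q` is constant, so reading it at the threshold index already bounds
    -- `abs q`.
    abs≤1 = ≤-from-slack λ ε 0<ε → proj₂ (∣q∣≤1 ε 0<ε) _ ℕₚ.≤-refl
    bound : ∀ ε z → 0ℚ < ε → abs z ≤ 1ℚ + ½ * ε → abs (q * z - 1ℚ) < ½ * ε → 1ℚ ≤ abs q + ε
    bound ε z 0<ε le close = begin
      1ℚ                                      ≡⟨ abs-1 ⟨
      abs 1ℚ                                  ≡⟨ cong abs (solve 2 (λ e t → e := t :+ :- (t :- e)) refl 1ℚ (q * z)) ⟩
      abs (q * z + - (q * z - 1ℚ))            ≤⟨ abs-+ (q * z) (- (q * z - 1ℚ)) ⟩
      abs (q * z) + abs (- (q * z - 1ℚ))      ≡⟨ cong₂ _+_ (abs-* q z) (abs-neg (q * z - 1ℚ)) ⟩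
      abs q * abs z + abs (q * z - 1ℚ)        ≤⟨ ℚₚ.+-mono-≤ (*-monoˡ-≤ (abs-nonNeg q) le) (ℚₚ.<⇒≤ close) ⟩
      abs q * (1ℚ + h) + h                    ≡⟨ cong (_+ h) (trans (ℚₚ.*-distribˡ-+ (abs q) 1ℚ h) (cong (_+ abs q * h) (ℚₚ.*-identityʳ (abs q)))) ⟩
      abs q + abs q * h + h                   ≤⟨ ℚₚ.+-monoˡ-≤ h (ℚₚ.+-monoʳ-≤ (abs q) (*-monoʳ-≤ (ℚₚ.<⇒≤ (half-pos 0<ε)) abs≤1)) ⟩
      abs q + 1ℚ * h + h                      ≡⟨ trans (cong (λ t → abs q + t + h) (ℚₚ.*-identityˡ h)) (ℚₚ.+-assoc (abs q) h h) ⟩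
      abs q + (h + h)                         ≡⟨ cong (λ t → abs q + t) (half+half ε) ⟩
      abs q + ε                               ∎
      where h = ½ * ε
    1≤abs+ε : ∀ ε → 0ℚ < ε → 1ℚ ≤ abs q + ε
    1≤abs+ε ε 0<ε =
      let m , near = eventually₂ (λ _ → _,_) (∣y∣≤1 (½ * ε) (half-pos 0<ε)) (qy≈1 (½ * ε) (half-pos 0<ε))
          le , close = near m ℕₚ.≤-refl
      in bound ε (seq y m) 0<ε le close

-- The geometric series and the inverse of 1 - x

module _ {V : AbsoluteValue} (x : Completion V) (∣x∣<1 : ∣ x ∣ <ᴿ ι 1ℚ) where

  open AbsoluteValue V
  open ℚₚ.≤-Reasoning
  open +-*-Solver

  private
    -- The hypothesis unpacks to a rational gap: |xₘ| + ε ≤ 1 for all m ≥ N.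
    ε = proj₁ ∣x∣<1
    0<ε = proj₁ (proj₂ ∣x∣<1)
    N = proj₁ (proj₂ (proj₂ ∣x∣<1))
    gap = proj₂ (proj₂ (proj₂ ∣x∣<1))

  -- A total reciprocal is taken because 1 - xₘ may vanish for m < N; finitely many terms do not
  -- affect the limit.
  geometricSeq : ℕ → ℚ
  geometricSeq m = recip (1ℚ - seq x m)

  ε≤abs[1-x] : ∀ m → N ℕ.≤ m → ε ≤ abs (1ℚ - seq x m)
  ε≤abs[1-x] m N≤m = +-cancelʳ-≤ (abs s) (begin
    ε + abs s                 ≡⟨ ℚₚ.+-comm ε (abs s) ⟩
    abs s + ε                 ≤⟨ gap m N≤m ⟩
    1ℚ                        ≡⟨ abs-1 {V} ⟨
    abs 1ℚ                    ≡⟨ cong abs (solve 1 (λ s → con 1ℚ := (con 1ℚ :- s) :+ s) refl s) ⟩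
    abs (1ℚ - s + s)          ≤⟨ abs-+ (1ℚ - s) s ⟩
    abs (1ℚ - s) + abs s      ∎)
    where s = seq x m

  geometricSeq-inverse : ∀ m → N ℕ.≤ m → (1ℚ - seq x m) * geometricSeq m ≡ 1ℚ
  geometricSeq-inverse m N≤m = *-recip λ e →
    <⇒≱ 0<ε (subst (ε ≤_) (trans (cong abs e) abs-0) (ε≤abs[1-x] m N≤m))

  abs-geometricSeq : ∀ m → N ℕ.≤ m → ε * abs (geometricSeq m) ≤ 1ℚ
  abs-geometricSeq m N≤m = begin
    ε * abs y                    ≤⟨ *-monoʳ-≤ (abs-nonNeg y) (ε≤abs[1-x] m N≤m) ⟩
    abs (1ℚ - seq x m) * abs y   ≡⟨ abs-* (1ℚ - seq x m) y ⟨
    abs ((1ℚ - seq x m) * y)     ≡⟨ cong abs (geometricSeq-inverse m N≤m) ⟩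
    abs 1ℚ                       ≡⟨ abs-1 {V} ⟩
    1ℚ                           ∎
    where y = geometricSeq m

  -- 1/(1 − xₘ) − 1/(1 − xₙ) = (xₘ − xₙ) / ((1 − xₘ)(1 − xₙ)), where |1 − xₘ|, |1 − xₙ| ≥ ε.
  geometricSeq-isCauchy : IsCauchy V geometricSeq
  geometricSeq-isCauchy η 0<η with isCauchy x (ε * ε * η) (*-pos (*-pos 0<ε 0<ε) 0<η)
  ... | M , close = N ℕ.⊔ M , λ m n le le′ →
    go m n (ℕₚ.m⊔n≤o⇒m≤o N M le) (ℕₚ.m⊔n≤o⇒m≤o N M le′)
      (close m n (ℕₚ.m⊔n≤o⇒n≤o N M le) (ℕₚ.m⊔n≤o⇒n≤o N M le′))
    where
    0≤ε = ℚₚ.<⇒≤ 0<ε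
    0≤ε² = *-nonNeg 0≤ε 0≤ε
    go : ∀ m n → N ℕ.≤ m → N ℕ.≤ n → abs (seq x m - seq x n) < ε * ε * η →
      abs (geometricSeq m - geometricSeq n) < η
    go m n N≤m N≤n lt = ℚₚ.*-cancelˡ-<-nonNeg (ε * ε) {{ℚ.nonNegative 0≤ε²}} (begin-strict
      ε * ε * abs (y - z)                     ≡⟨ cong (λ t → ε * ε * abs t) diff ⟩
      ε * ε * abs (d * (y * z))               ≡⟨ cong (ε * ε *_) (trans (abs-* d (y * z)) (cong (abs d *_) (abs-* y z))) ⟩
      ε * ε * (abs d * (abs y * abs z))       ≡⟨ solve 4 (λ e d y z → e :* e :* (d :* (y :* z)) := d :* (e :* y :* (e :* z))) refl ε (abs d) (abs y) (abs z) ⟩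
      abs d * (ε * abs y * (ε * abs z))       ≤⟨ *-monoˡ-≤ (abs-nonNeg d) (*-monoˡ-≤ (*-nonNeg 0≤ε (abs-nonNeg y)) (abs-geometricSeq n N≤n)) ⟩
      abs d * (ε * abs y * 1ℚ)                ≡⟨ cong (abs d *_) (ℚₚ.*-identityʳ (ε * abs y)) ⟩
      abs d * (ε * abs y)                     ≤⟨ *-monoˡ-≤ (abs-nonNeg d) (abs-geometricSeq m N≤m) ⟩
      abs d * 1ℚ                              ≡⟨ ℚₚ.*-identityʳ (abs d) ⟩
      abs d                                   <⟨ lt ⟩
      ε * ε * η                               ∎)
      where
      y = geometricSeq m
      z = geometricSeq n
      d = seq x m - seq x n
      diff : y - z ≡ d * (y * z)
      diff = ≡R.begin
        y - z                                                         ≡R.≡⟨ cong₂ _-_ (ℚₚ.*-identityʳ y) (ℚₚ.*-identityʳ z) ⟨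
        y * 1ℚ - z * 1ℚ                                               ≡R.≡⟨ cong₂ (λ s t → y * s - z * t) (geometricSeq-inverse n N≤n) (geometricSeq-inverse m N≤m) ⟨
        y * ((1ℚ - seq x n) * z) - z * ((1ℚ - seq x m) * y)           ≡R.≡⟨ solve 4 (λ y z a b → y :* ((con 1ℚ :- b) :* z) :- z :* ((con 1ℚ :- a) :* y) := (a :- b) :* (y :* z)) refl y z (seq x m) (seq x n) ⟩
        d * (y * z)                                                   ≡R.∎
        where module ≡R = ≡-Reasoning

  geometric : Completion V
  geometric = cauchy geometricSeq geometricSeq-isCauchy

  1-x*geometric≈1 : (ι 1ℚ -ᶜ x) *ᶜ geometric ≈ ι 1ℚ
  1-x*geometric≈1 η 0<η = N , λ m N≤m → subst (_< η)
    (sym (trans (cong (λ t → abs (t - 1ℚ)) (geometricSeq-inverse m N≤m)) abs-0)) 0<η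

  -- By the ultrametric inequality, 1 = |(1 - s) + s| is at most |1 - s| or at most |s|. The gap
  -- rules out the second, so |1 - s| ≥ 1 and its reciprocal has absolute value at most 1.
  geometric-≤1 : (∀ p q → abs (p + q) ≤ abs p ⊎ abs (p + q) ≤ abs q) → ∣ geometric ∣ ≤ᴿ ι 1ℚ
  geometric-≤1 ultrametric η 0<η = N , λ m N≤m → ℚₚ.≤-trans (bound m N≤m) (p≤p+q (ℚₚ.<⇒≤ 0<η))
    where
    1≤abs[1-x] : ∀ m → N ℕ.≤ m → 1ℚ ≤ abs (1ℚ - seq x m)
    1≤abs[1-x] m N≤m = subst (_≤ abs (1ℚ - s)) abs≡1
      ([ (λ le → le)
       , (λ le → contradiction (subst (_≤ abs s) abs≡1 le) (<⇒≱ (ℚₚ.<-≤-trans (p<p+q 0<ε) (gap m N≤m)))) ]′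
       (ultrametric (1ℚ - s) s))
      where
      s = seq x m
      abs≡1 : abs (1ℚ - s + s) ≡ 1ℚ
      abs≡1 = trans (cong abs (solve 1 (λ s → con 1ℚ :- s :+ s := con 1ℚ) refl s)) (abs-1 {V})
    bound : ∀ m → N ℕ.≤ m → abs (geometricSeq m) ≤ 1ℚ
    bound m N≤m = begin
      abs y                          ≡⟨ ℚₚ.*-identityˡ (abs y) ⟨
      1ℚ * abs y                     ≤⟨ *-monoʳ-≤ (abs-nonNeg y) (1≤abs[1-x] m N≤m) ⟩
      abs (1ℚ - seq x m) * abs y     ≡⟨ abs-* (1ℚ - seq x m) y ⟨
      abs ((1ℚ - seq x m) * y)       ≡⟨ cong abs (geometricSeq-inverse m N≤m) ⟩
      abs 1ℚ                         ≡⟨ abs-1 {V} ⟩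
      1ℚ                             ∎
      where y = geometricSeq m

  module _ (k : ℕ → ℚ) (k≡1 : ∀ n → k n ≡ 1ℚ) where

    private
      S : ℕ → ℕ → ℚ
      S n m = seq (partialSum (powerSeriesTerm k x) n) m

    -- Stated without division, so that it also holds at indices where 1 - xₘ is zero.
    partialSum-telescopes : ∀ n m → (1ℚ - seq x m) * S n m ≡ 1ℚ - seq x m ^ℚ n
    partialSum-telescopes zero    m = ℚₚ.*-zeroʳ (1ℚ - seq x m)
    partialSum-telescopes (suc n) m = ≡R.begin
      (1ℚ - s) * (S n m + k n * seq (x ^ n) m)   ≡R.≡⟨ cong₂ (λ c w → (1ℚ - s) * (S n m + c * w)) (k≡1 n) (seq-^ x n m) ⟩
      (1ℚ - s) * (S n m + 1ℚ * w)                ≡R.≡⟨ solve 3 (λ s S w → (con 1ℚ :- s) :* (S :+ con 1ℚ :* w) := (con 1ℚ :- s) :* S :+ (w :- s :* w)) refl s (S n m) w ⟩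
      (1ℚ - s) * S n m + (w - s * w)             ≡R.≡⟨ cong (_+ (w - s * w)) (partialSum-telescopes n m) ⟩
      1ℚ - w + (w - s * w)                       ≡R.≡⟨ solve 2 (λ w v → con 1ℚ :- w :+ (w :- v) := con 1ℚ :- v) refl w (s * w) ⟩
      1ℚ - s * w                                 ≡R.∎
      where
      module ≡R = ≡-Reasoning
      s = seq x m
      w = s ^ℚ n

    -- The remainder of the geometric series is -sⁿ/(1 - s). Scaling by ε turns the bound on 1/(1 -
    -- s) into `ε * abs y ≤ 1`.
    partialSum-near : ∀ η n m → N ℕ.≤ m → abs (seq x m) ^ℚ n ≤ ε * η → abs (S n m - geometricSeq m) ≤ η
    partialSum-near η n m N≤m le = *-cancelˡ-≤ 0<ε (begin
      ε * abs (S n m - y)            ≡⟨ cong (λ t → ε * abs t) diff ⟩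
      ε * abs (- (w * y))            ≡⟨ cong (ε *_) (trans (abs-neg (w * y)) (abs-* w y)) ⟩
      ε * (abs w * abs y)            ≡⟨ solve 3 (λ e w y → e :* (w :* y) := w :* (e :* y)) refl ε (abs w) (abs y) ⟩
      abs w * (ε * abs y)            ≤⟨ *-monoˡ-≤ (abs-nonNeg w) (abs-geometricSeq m N≤m) ⟩
      abs w * 1ℚ                     ≡⟨ ℚₚ.*-identityʳ (abs w) ⟩
      abs w                          ≡⟨ abs-^ {V} s n ⟩
      abs s ^ℚ n                     ≤⟨ le ⟩
      ε * η                          ∎)
      where
      s = seq x m
      y = geometricSeq m
      w = s ^ℚ n
      diff : S n m - y ≡ - (w * y)
      diff = ≡R.begin
        S n m - y                             ≡R.≡⟨ cong (_- y) (ℚₚ.*-identityʳ (S n m)) ⟨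
        S n m * 1ℚ - y                        ≡R.≡⟨ cong (λ t → S n m * t - y) (geometricSeq-inverse m N≤m) ⟨
        S n m * ((1ℚ - s) * y) - y            ≡R.≡⟨ solve 3 (λ S s y → S :* ((con 1ℚ :- s) :* y) :- y := (con 1ℚ :- s) :* S :* y :- y) refl (S n m) s y ⟩
        (1ℚ - s) * S n m * y - y              ≡R.≡⟨ cong (λ t → t * y - y) (partialSum-telescopes n m) ⟩
        (1ℚ - w) * y - y                      ≡R.≡⟨ solve 2 (λ w y → (con 1ℚ :- w) :* y :- y := :- (w :* y)) refl w y ⟩
        - (w * y)                             ≡R.∎
        where module ≡R = ≡-Reasoning

    partialSum-near-geometric : ∀ η → 0ℚ < η → Eventually λ n → Eventually λ m → abs (S n m - geometricSeq m) ≤ η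
    partialSum-near-geometric η 0<η =
      let M , small = ^-vanishes 0<ε (*-pos 0<ε 0<η)
      in M , λ n M≤n → N , λ m N≤m → partialSum-near η n m N≤m (small n M≤n (abs-nonNeg (seq x m)) (gap m N≤m))

    geometric-hasSum : HasSum (powerSeriesTerm k x) geometric
    geometric-hasSum η 0<η =
      let M , near = partialSum-near-geometric (½ * η) (half-pos 0<η)
      -- The relation `_<ᴿ_` demands a rational gap: one half of η bounds the error and the other
      -- half is the gap.
      in M , λ n M≤n → ½ * η , half-pos 0<η , proj₁ (near n M≤n) , λ m le →
           p≤½ε⇒p+½ε≤ε η (proj₂ (near n M≤n) m le)

-- The series that terminates as 1 - x

module _ {V : AbsoluteValue} (x : Completion V) (k : ℕ → ℚ)
  (k₀ : k 0 ≡ 1ℚ) (k₁ : k 1 ≡ - 1ℚ) (k₂ : ∀ n → k (2 ℕ.+ n) ≡ 0ℚ) where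

  open ≡-Reasoning
  open +-*-Solver

  partialSum-linear : ∀ n m → seq (partialSum (powerSeriesTerm k x) (2 ℕ.+ n)) m ≡ 1ℚ - seq x m
  partialSum-linear zero m = begin
    0ℚ + k 0 * 1ℚ + k 1 * (s * 1ℚ)         ≡⟨ cong₂ (λ a b → 0ℚ + a * 1ℚ + b * (s * 1ℚ)) k₀ k₁ ⟩
    0ℚ + 1ℚ * 1ℚ + - 1ℚ * (s * 1ℚ)         ≡⟨ solve 1 (λ s → con 0ℚ :+ con 1ℚ :* con 1ℚ :+ con (- 1ℚ) :* (s :* con 1ℚ) := con 1ℚ :- s) refl s ⟩
    1ℚ - s                                 ∎
    where s = seq x m
  partialSum-linear (suc n) m = p+0*r≡q (seq (x ^ (2 ℕ.+ n)) m) (partialSum-linear n m) (k₂ n)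
    where
    p+0*r≡q : ∀ {p q z} r → p ≡ q → z ≡ 0ℚ → p + z * r ≡ q
    p+0*r≡q {p} r refl refl = trans (cong (λ t → p + t) (ℚₚ.*-zeroˡ r)) (ℚₚ.+-identityʳ p)

  partialSum-near-linear : ∀ η → 0ℚ < η → Eventually λ n → Eventually λ m →
    AbsoluteValue.abs V (seq (partialSum (powerSeriesTerm k x) n) m - (1ℚ - seq x m)) ≤ η
  -- From index 2 on both nonzero terms are included, so the error is exactly zero. Matching on the
  -- proof of 2 ≤ n exhibits n as a double successor.
  partialSum-near-linear η 0<η = 2 , λ { _ (ℕ.s≤s (ℕ.s≤s (ℕ.z≤n {n}))) → 0 , λ m _ → near (partialSum-linear n m) }
    where
    open AbsoluteValue V
    near : ∀ {p q} → p ≡ q → abs (p - q) ≤ η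
    near {p} refl = ℚₚ.≤-trans (ℚₚ.≤-reflexive (trans (cong abs (ℚₚ.+-inverseʳ p)) abs-0)) (ℚₚ.<⇒≤ 0<η)

  linear-hasSum : HasSum (powerSeriesTerm k x) (ι 1ℚ -ᶜ x)
  linear-hasSum η 0<η =
    let M , near = partialSum-near-linear (½ * η) (half-pos 0<η)
    in M , λ n M≤n → ½ * η , half-pos 0<η , proj₁ (near n M≤n) , λ m le →
         p≤½ε⇒p+½ε≤ε η (proj₂ (near n M≤n) m le)

-- Rational numbers that are units at every prime

module _ (p : ℕ) (pr : Prime p) where

  open ValuationProperties p pr
  open PadicAbs p pr

  N-unit : ∀ {n} → p ∤ n → N n ≡ 1ℚ
  N-unit {n} p∤n = trans (N≡R n n≢0)
    (cong R (valuation-unique 0 n n n≢0 (sym (ℕₚ.*-identityˡ n)) p∤n))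
    where
    n≢0 : n ≢ 0
    n≢0 refl = p∤n (p ℕ∣.∣0)

  -- For nonzero `n` the valuation is at least 1, so p^v > 1 and its reciprocal cannot be 1; for `n`
  -- zero the value is 0 by definition.
  N-multiple : ∀ {n} → p ∣ n → N n ≢ 1ℚ
  N-multiple {zero}      p∣n = λ ()
  N-multiple {n@(suc _)} p∣n R≡1 = ℕₚ.<⇒≱ 1<p^v (ℕₚ.≤-reflexive p^v≡1)
    where
    v = valuation p n
    1<p^v : 1 ℕ.< p ℕ.^ v
    1<p^v = ℕₚ.≤-trans 1<p (ℕₚ.≤-trans (ℕₚ.≤-reflexive (sym (ℕₚ.^-identityʳ p)))
      (ℕₚ.^-monoʳ-≤ p (^∣⇒≤valuation 1 n (λ ()) (subst (_∣ n) (sym (ℕₚ.^-identityʳ p)) p∣n))))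
    P≡1 : P v ≡ 1ℚ
    P≡1 = trans (sym (ℚₚ.*-identityˡ (P v))) (trans (cong (_* P v) (sym R≡1)) (R*P v))
    p^v≡1 : p ℕ.^ v ≡ 1
    p^v≡1 = ℤₚ.+-injective (trans (sym (ℤₚ.*-identityʳ _)) (ℚᵘₚ.drop-*≡* (ℚᵘₚ.≃-trans
      (ℚᵘₚ.≃-sym (ℚₚ.toℚᵘ-fromℚᵘ (ℚᵘ.mkℚᵘ (+ (p ℕ.^ v)) 0))) (ℚₚ.toℚᵘ-cong P≡1))))

  -- Absolute value 1 gives numerator and denominator the same p-adic size, so `p` divides both or
  -- neither; lowest terms exclude both.
  A≡1⇒∤ : ∀ q → A q ≡ 1ℚ → p ∤ ℤ.∣ ↥ q ∣ × p ∤ ↧ₙ q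
  A≡1⇒∤ q@(mkℚ _ _ coprime) A≡1 = (λ d → coprime-p d (transfer (sym N↧≡N↥) d))
                                , (λ d → coprime-p (transfer N↧≡N↥ d) d)
    where
    N↧≡N↥ : N (↧ₙ q) ≡ N ℤ.∣ ↥ q ∣
    N↧≡N↥ = trans (sym (ℚₚ.*-identityˡ (N (↧ₙ q)))) (trans (cong (_* N (↧ₙ q)) (sym A≡1)) (A*N↧ q))
    coprime-p : p ∣ ℤ.∣ ↥ q ∣ → p ∤ ↧ₙ q
    coprime-p d d′ = ℕₚ.<⇒≢ 1<p (sym (Coprimality.recompute coprime (d , d′)))
    transfer : ∀ {m n} → N m ≡ N n → p ∣ m → p ∣ n
    transfer {m} {n} eq d with p ∣? n
    ... | yes p∣n = p∣n
    ... | no  p∤n = contradiction (trans eq (N-unit p∤n)) (N-multiple d)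

isPadicUnit⇒∤ : ∀ p (pr : Prime p) q → IsPadicUnit p pr (ι q) → p ∤ ℤ.∣ ↥ q ∣ × p ∤ ↧ₙ q
isPadicUnit⇒∤ p pr q (q-int , y , y-int , qy≈1) = A≡1⇒∤ p pr q (abs-unit {padic p pr} q y q-int y-int qy≈1)

noPrimeDivisor⇒≡1 : ∀ {n} → (∀ p → Prime p → p ∤ n) → n ≡ 1
-- Zero is divisible by every prime; 2 serves as a concrete one.
noPrimeDivisor⇒≡1 {zero} ∤n = contradiction (2 ℕ∣.∣0) (∤n 2 prime[2])
noPrimeDivisor⇒≡1 {n@(suc _)} ∤n with factorise n
... | record { factors = []     ; isFactorisation = eq } = eq
... | record { factors = p ∷ ps ; isFactorisation = eq ; factorsPrime = pr ∷ _ } =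
  contradiction (subst (p ∣_) (sym eq) (ℕ∣.m∣m*n (product ps))) (∤n p pr)

units⇒±1 : ∀ q → ℤ.∣ ↥ q ∣ ≡ 1 → ↧ₙ q ≡ 1 → q ≡ 1ℚ ⊎ q ≡ - 1ℚ
units⇒±1 (mkℚ (+ 1)      0 _) refl refl = inj₁ refl
units⇒±1 (mkℚ -[1+ 0 ]   0 _) refl refl = inj₂ refl

isPadicUnit⇒±1 : ∀ q → (∀ p (pr : Prime p) → IsPadicUnit p pr (ι q)) → q ≡ 1ℚ ⊎ q ≡ - 1ℚ
isPadicUnit⇒±1 q unit = units⇒±1 q
  (noPrimeDivisor⇒≡1 λ p pr → proj₁ (isPadicUnit⇒∤ p pr q (unit p pr)))
  (noPrimeDivisor⇒≡1 λ p pr → proj₂ (isPadicUnit⇒∤ p pr q (unit p pr)))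

-- The coefficients for a = ±1

-- The factors (c)ₙ cancel, leaving (a)ₙ/n!. The hypothesis presents this quotient as `t` in
-- multiplied-out form.
hypergeometricCoefficient-b≡c : ∀ a c (c∉ : NotNonPositiveInteger c) {n t} →
  pochhammer a n ≡ t * (+ (n !) / 1) → hypergeometricCoefficient a c c c∉ n ≡ t
hypergeometricCoefficient-b≡c a c c∉ {n} {t} eq = begin
  pochhammer a n * C * 1/D     ≡⟨ cong (λ u → u * C * 1/D) eq ⟩
  t * F * C * 1/D              ≡⟨ solve 4 (λ t F C i → t :* F :* C :* i := t :* (C :* F :* i)) refl t F C 1/D ⟩
  t * (C * F * 1/D)            ≡⟨ cong (t *_) (ℚₚ.*-inverseʳ (C * F) {{C*F≢0}}) ⟩
  t * 1ℚ                       ≡⟨ ℚₚ.*-identityʳ t ⟩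
  t                            ∎
  where
  open ≡-Reasoning
  open +-*-Solver
  C = pochhammer c n
  F = + (n !) / 1
  C*F≢0 = ℚ.≢-nonZero (*-≢0 (pochhammer-≢0 c∉ n) (factorial-≢0 n))
  1/D = (1/ (C * F)) {{C*F≢0}}

-- PadicAbs.*-/1 does not depend on the prime, so 2 is arbitrary.
pochhammer-1 : ∀ n → pochhammer 1ℚ n ≡ + (n !) / 1
pochhammer-1 zero    = refl
pochhammer-1 (suc n) = begin
  pochhammer 1ℚ n * (1ℚ + + n / 1)     ≡⟨ cong₂ _*_ (pochhammer-1 n) (1+n/1 n) ⟩
  (+ (n !) / 1) * (+ suc n / 1)        ≡⟨ PadicAbs.*-/1 2 prime[2] (n !) (suc n) ⟨
  + (n ! ℕ.* suc n) / 1                ≡⟨ cong (λ k → + k / 1) (ℕₚ.*-comm (n !) (suc n)) ⟩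
  + (suc n !) / 1                      ∎
  where open ≡-Reasoning

-- The factor of index 1 is -1 + 1 = 0, and it persists in all later products.
pochhammer-[-1] : ∀ n → pochhammer (- 1ℚ) (2 ℕ.+ n) ≡ 0ℚ
pochhammer-[-1] zero    = refl
pochhammer-[-1] (suc n) = trans (cong (_* (- 1ℚ + + (2 ℕ.+ n) / 1)) (pochhammer-[-1] n)) (ℚₚ.*-zeroˡ (- 1ℚ + + (2 ℕ.+ n) / 1))

module _ {a : ℚ} (c : ℚ) (c∉ : NotNonPositiveInteger c) where

  coefficient-1 : a ≡ 1ℚ → ∀ n → hypergeometricCoefficient a c c c∉ n ≡ 1ℚ
  coefficient-1 refl n = hypergeometricCoefficient-b≡c 1ℚ c c∉ {n}
    (trans (pochhammer-1 n) (sym (ℚₚ.*-identityˡ (+ (n !) / 1))))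

  coefficient-[-1]-0 : a ≡ - 1ℚ → hypergeometricCoefficient a c c c∉ 0 ≡ 1ℚ
  coefficient-[-1]-0 refl = hypergeometricCoefficient-b≡c (- 1ℚ) c c∉ {0} {1ℚ} refl

  coefficient-[-1]-1 : a ≡ - 1ℚ → hypergeometricCoefficient a c c c∉ 1 ≡ - 1ℚ
  coefficient-[-1]-1 refl = hypergeometricCoefficient-b≡c (- 1ℚ) c c∉ {1} { - 1ℚ} refl

  coefficient-[-1]-2+ : a ≡ - 1ℚ → ∀ n → hypergeometricCoefficient a c c c∉ (2 ℕ.+ n) ≡ 0ℚ
  coefficient-[-1]-2+ refl n = hypergeometricCoefficient-b≡c (- 1ℚ) c c∉ {2 ℕ.+ n} {0ℚ}
    (trans (pochhammer-[-1] n) (sym (ℚₚ.*-zeroˡ (+ ((2 ℕ.+ n) !) / 1))))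

  module _ {V : AbsoluteValue} (x : Completion V) where

    hypergeometricSum-1 : a ≡ 1ℚ → (∣x∣<1 : ∣ x ∣ <ᴿ ι 1ℚ) → IsHypergeometricSum a c c c∉ x (geometric x ∣x∣<1)
    hypergeometricSum-1 a≡1 ∣x∣<1 =
      geometric-hasSum x ∣x∣<1 (hypergeometricCoefficient a c c c∉) (coefficient-1 a≡1)

    hypergeometricSum-[-1] : a ≡ - 1ℚ → IsHypergeometricSum a c c c∉ x (ι 1ℚ -ᶜ x)
    hypergeometricSum-[-1] a≡-1 =
      linear-hasSum x (hypergeometricCoefficient a c c c∉) (coefficient-[-1]-0 a≡-1) (coefficient-[-1]-1 a≡-1)
        (coefficient-[-1]-2+ a≡-1)

-- Uniqueness of the sum

hypergeometricSum-unique : ∀ a b c (c∉ : NotNonPositiveInteger c) {V} (x s s′ : Completion V) →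
  IsHypergeometricSum a b c c∉ x s → IsHypergeometricSum a b c c∉ x s′ → s ≈ s′
hypergeometricSum-unique a b c c∉ {V} x s s′ F⟶s F⟶s′ ε 0<ε =
  let M , near  = F⟶s (½ * ε) (half-pos 0<ε)
      L , near′ = F⟶s′ (½ * ε) (half-pos 0<ε)
      -- A single partial sum, past both thresholds, is compared with both limits; after that only
      -- the index inside the Cauchy sequences varies.
      n = M ℕ.⊔ L
      δ , 0<δ , K , close  = near n (ℕₚ.m≤m⊔n M L)
      δ′ , 0<δ′ , J , close′ = near′ n (ℕₚ.m≤n⊔m M L)
  in K ℕ.⊔ J , λ m le → triangle (seq s m) (seq s′ m) (seq (S n) m)
       (ℚₚ.<-≤-trans (p<p+q 0<δ) (close m (ℕₚ.m⊔n≤o⇒m≤o K J le)))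
       (ℚₚ.<-≤-trans (p<p+q 0<δ′) (close′ m (ℕₚ.m⊔n≤o⇒n≤o K J le)))
  where
  open AbsoluteValue V
  open +-*-Solver
  S : ℕ → Completion V
  S = partialSum (powerSeriesTerm (hypergeometricCoefficient a b c c∉) x)
  triangle : ∀ p q r → abs (r - p) < ½ * ε → abs (r - q) < ½ * ε → abs (p - q) < ε
  triangle p q r r-p r-q = split {V} ε (subst (_< ½ * ε) (abs-sub-comm {V} r p) r-p) r-q
    (solve 3 (λ p q r → p :- q := (p :- r) :+ (r :- q)) refl p q r)

-- Ideles

private module K v = CommutativeRing (completionRing (absoluteValueAt v))

isAdele-cong : ∀ {x y : PlaceSequence} → (∀ v → x v ≈ y v) → IsAdele x → IsAdele y
isAdele-cong {x} {y} x≈y (S , h) = S , λ p pr p∉S →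
  ∣-∣≤-cong {x = x (finite p pr)} {y (finite p pr)} 1ℚ (x≈y (finite p pr)) (h p pr p∉S)

-- Commutativity at each place supplies the other one-sided inverse law. Integrality of the inverse
-- outside a finite set has to be given separately, as `y∈𝔸`.
invertible⇒isIdele : ∀ {x y : PlaceSequence} → IsAdele x → IsAdele y → (∀ v → x v *ᶜ y v ≈ ι 1ℚ) → IsIdele x
invertible⇒isIdele {x} {y} x∈𝔸 y∈𝔸 xy≈1 = x∈𝔸 , (y , y∈𝔸) ,
  (λ v → K.trans v {y v *ᶜ x v} {x v *ᶜ y v} {ι 1ℚ} (K.*-comm v (y v) (x v)) (xy≈1 v)) , xy≈1

isIdele-cong : ∀ {x y : PlaceSequence} → (∀ v → x v ≈ y v) → IsIdele x → IsIdele y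
isIdele-cong {x} {y} x≈y (x∈𝔸 , (z , z∈𝔸) , _ , xz≈1) =
  invertible⇒isIdele {y} {z} (isAdele-cong {x} {y} x≈y x∈𝔸) z∈𝔸 λ v →
    K.trans v {y v *ᶜ z v} {x v *ᶜ z v} {ι 1ℚ}
      (K.*-cong v {y v} {x v} {z v} {z v} (K.sym v {x v} {y v} (x≈y v)) (K.refl v {z v})) (xz≈1 v)

theorem4p12 : (a b c : ℚ) →
    (∀ (p : ℕ) (pr : Prime p) → IsPadicUnit p pr (ι a)) →
    b ≡ c →
    (c∉ : NotNonPositiveInteger c) →
    (x : PlaceSequence) → IsAdele x →
    (∀ (v : Place) → ∣ x v ∣ <ᴿ ι 1ℚ) →
    (∀ (v : Place) → ∃[ s ] IsHypergeometricSum a b c c∉ (x v) s)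
    × (∀ (G : PlaceSequence) →
    (∀ (v : Place) → IsHypergeometricSum a b c c∉ (x v) (G v)) →
    IsIdele G × IsAdele G)
theorem4p12 a b c unit refl c∉ x x∈𝔸 ∣x∣<1 =
  [ (λ a≡1 → fromSum (λ v → geometric (x v) (∣x∣<1 v)) geometric-idele λ v → hypergeometricSum-1 c c∉ (x v) a≡1 (∣x∣<1 v))
  , (λ a≡-1 → fromSum (λ v → ι 1ℚ -ᶜ x v) 1-x-idele λ v → hypergeometricSum-[-1] c c∉ (x v) a≡-1)
  ]′ (isPadicUnit⇒±1 a unit)
  where
  1-x∈𝔸 : IsAdele λ v → ι 1ℚ -ᶜ x v
  1-x∈𝔸 = proj₂ (addAdele oneAdele (negAdele (x , x∈𝔸)))
  geometric∈𝔸 : IsAdele λ v → geometric (x v) (∣x∣<1 v)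
  -- No exceptional primes occur, because |x|ₚ < 1 is assumed at every prime.
  geometric∈𝔸 = [] , λ p pr _ → geometric-≤1 (x (finite p pr)) (∣x∣<1 (finite p pr)) (padic-ultrametric p pr)
  1-x-idele : IsIdele λ v → ι 1ℚ -ᶜ x v
  1-x-idele = invertible⇒isIdele {λ v → ι 1ℚ -ᶜ x v} {λ v → geometric (x v) (∣x∣<1 v)} 1-x∈𝔸 geometric∈𝔸 λ v → 1-x*geometric≈1 (x v) (∣x∣<1 v)
  geometric-idele : IsIdele λ v → geometric (x v) (∣x∣<1 v)
  -- The two sequences are inverse to each other, so the left and right inverse laws of `1-x-idele`
  -- are swapped.
  geometric-idele = geometric∈𝔸 , ((λ v → ι 1ℚ -ᶜ x v) , 1-x∈𝔸) , proj₂ (proj₂ (proj₂ 1-x-idele)) , proj₁ (proj₂ (proj₂ 1-x-idele))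
  fromSum : (L : PlaceSequence) → IsIdele L → (∀ v → IsHypergeometricSum a c c c∉ (x v) (L v)) →
    (∀ v → ∃[ s ] IsHypergeometricSum a c c c∉ (x v) s)
    × (∀ G → (∀ v → IsHypergeometricSum a c c c∉ (x v) (G v)) → IsIdele G × IsAdele G)
  -- The explicit sum `L` proves existence; any other sequence of sums `G` agrees with it at each
  -- place by uniqueness and so inherits the idele property.
  fromSum L L-idele L-sum = (λ v → L v , L-sum v) , λ G G-sum →
    let G-idele = isIdele-cong {L} {G}
          (λ v → hypergeometricSum-unique a c c c∉ (x v) (L v) (G v) (L-sum v) (G-sum v)) L-idele
    in G-idele , proj₁ G-idele
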